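{- Let $G$ be a simple graph and let $n,m$ be integers with $0<m<n$. Then the following statements are equivalent: 1) $iso(G-S)\leq \frac{n}{m}|S|$ for every $S \subset V(G)$. 2) $G$ has a fractional $[1,\frac{n}{m}]$-factor. 3) $G$ has a fractional $[1,\frac{n}{m}]$-factor with values in $\{0,\frac{1}{m},\dots,\frac{m-1}{m},1\}$. 4) $G$ has a $\{C_{2i+1},T \colon 1 \leq i < \frac{m}{n-m},\ T\in\mathcal{T}_{\frac{n}{m}}\}$-factor.
   Context: Graphs are finite. For a graph $G$ and $S\subset V(G)$, $G-S$ is the subgraph induced by $V(G)\setminus S$, and $iso(H)$ denotes the number of isolated vertices of a graph $H$. For $e\in E(G)$, $G-e$ is $G$ with the edge $e$ deleted. For $h:E(G)\to[0,1]$ and $v\in V(G)$ let $d^h(v)=\sum_{e \ni v} h(e)$ (sum over edges incident with $v$). A fractional $[a,b]$-factor of $G$ is a function $h:E(G)\to[0,1]$ with $a\le d^h(v)\le b$ for all $v\in V(G)$. $C_k$ denotes the cycle on $k$ vertices. For a set $\mathcal{G}$ of graphs, a $\mathcal{G}$-factor of $G$ is a spanning subgraph of $G$ each of whose components is isomorphic to an element of $\mathcal{G}$. $\mathcal{T}_{\frac{n}{m}}$ is the set of trees $T$ such that (a) $iso(T-S)\le \frac{n}{m}|S|$ for all $S\subset V(T)$, and (b) for every $e\in E(T)$ there is a set $S^*\subset V(T)$ with $iso((T-e)-S^*)>\frac{n}{m}|S^*|$.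
   Formalization: In statements 2) and 3) a fractional [1, n/m]-factor is formalized as a function h with rational values in [0,1] on the edges, where the English allows arbitrary real values in [0,1]. -}

module Defs where

open import Data.Nat as ℕ using (ℕ; zero; suc; NonZero; _∸_)
open import Data.Integer using (+_)
open import Data.Rational using (ℚ; _/_; _+_; _*_; _≤_; _<_; 0ℚ; 1ℚ)
open import Data.Fin using (Fin; _≟_; toℕ)
open import Data.Fin.Subset using (Subset; ∣_∣)
open import Data.Vec using (lookup)
open import Data.List using (List; allFin; foldr; map; filter; length)
open import Data.Bool using (Bool; true; false; not; _∧_; _∨_; if_then_else_; T)
open import Data.Product using (Σ; ∃; _×_; _,_)
open import Data.Sum using (_⊎_)
open import Relation.Binary.PropositionalEquality using (_≡_)
open import Relation.Nullary using (¬_)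
open import Relation.Nullary.Decidable using (⌊_⌋)
open import Function.Definitions using (Injective)

record Graph (N : ℕ) : Set where
  field
    adj   : Fin N → Fin N → Bool
    adjSym : ∀ u v → adj u v ≡ adj v u
    adjIrr : ∀ v → adj v v ≡ false
open Graph public

ℕtoℚ : ℕ → ℚ
ℕtoℚ k = (+ k) / 1

isIsolatedIn- : ∀ {N} → Graph N → Subset N → Fin N → Bool
isIsolatedIn- G S v =
  not (lookup S v) ∧ foldr (λ u b → (not (adj G v u) ∨ lookup S u) ∧ b) true (allFin _)

iso- : ∀ {N} → Graph N → Subset N → ℕ
iso- G S = length (filter (λ v → T? (isIsolatedIn- G S v)) (allFin _))
  where
    open import Data.Bool.Properties using () renaming (T? to T?)

deleteEdge : ∀ {N} → Graph N → Fin N → Fin N → Graph N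
deleteEdge {N} G a b = record
  { adj = λ x y → adj G x y ∧ not (isAB x y ∨ isAB y x)
  ; adjSym = symm
  ; adjIrr = λ v → irr v
  }
  where
    isAB : Fin N → Fin N → Bool
    isAB x y = ⌊ x ≟ a ⌋ ∧ ⌊ y ≟ b ⌋
    open import Data.Bool.Properties using (∨-comm)
    open import Relation.Binary.PropositionalEquality using (cong₂; cong)
    symm : ∀ x y → (adj G x y ∧ not (isAB x y ∨ isAB y x)) ≡ (adj G y x ∧ not (isAB y x ∨ isAB x y))
    symm x y = cong₂ _∧_ (Graph.adjSym G x y) (cong not (∨-comm (isAB x y) (isAB y x)))
    irr : ∀ v → (adj G v v ∧ not (isAB v v ∨ isAB v v)) ≡ false
    irr v rewrite Graph.adjIrr G v = Relation.Binary.PropositionalEquality.refl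

data Reach {N} (G : Graph N) : Fin N → Fin N → Set where
  here : ∀ {v} → Reach G v v
  step : ∀ {u v w} → adj G u v ≡ true → Reach G v w → Reach G u w

Connected : ∀ {N} → Graph N → Set
Connected G = ∀ u v → Reach G u v

HasCycle : ∀ {N} → Graph N → Set
HasCycle {N} G =
  Σ ℕ λ ℓ → Σ (3 ℕ.≤ ℓ) λ ℓ≥3 → Σ (Fin ℓ → Fin N) λ f → Injective _≡_ _≡_ f ×
    (∀ (i : Fin ℓ) → adj G (f i) (f (next ℓ≥3 i)) ≡ true)
  where
    open import Data.Nat.DivMod using (_mod_)
    next : ∀ {ℓ} → 3 ℕ.≤ ℓ → Fin ℓ → Fin ℓ
    next {suc ℓ'} _ i = (suc (toℕ i)) mod (suc ℓ')

IsTree : ∀ {N} → Graph N → Set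
IsTree {N} G = (0 ℕ.< N) × Connected G × ¬ HasCycle G

InTq : ℚ → ∀ {k} → Graph k → Set
InTq q {k} T' =
  IsTree T'
  × (∀ (S : Subset k) → ℕtoℚ (iso- T' S) ≤ q * ℕtoℚ ∣ S ∣)
  × (∀ (a b : Fin k) → adj T' a b ≡ true →
       Σ (Subset k) λ S* → q * ℕtoℚ ∣ S* ∣ < ℕtoℚ (iso- (deleteEdge T' a b) S*))

-- The cycle C_k on vertex set Fin k (k ≥ 3): i adjacent to i±1 mod k.
-- (The guard "x ≠ y" is vacuous for k ≥ 3; it only makes looplessness definitional.)
cycleGraph : (k : ℕ) → 3 ℕ.≤ k → Graph k
cycleGraph (suc k') _ = record
  { adj = λ x y → (isSucc x y ∨ isSucc y x) ∧ not ⌊ x ≟ y ⌋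
  ; adjSym = λ x y → cong₂ _∧_ (∨-comm (isSucc x y) (isSucc y x)) (cong not (≟-sym x y))
  ; adjIrr = irr
  }
  where
    open import Data.Nat.DivMod using (_mod_)
    open import Data.Bool.Properties using (∨-comm; ∧-zeroʳ)
    open import Relation.Binary.PropositionalEquality using (cong₂; cong; refl; sym)
    open import Relation.Nullary using (yes; no)
    isSucc : Fin (suc k') → Fin (suc k') → Bool
    isSucc x y = ⌊ y ≟ (suc (toℕ x)) mod (suc k') ⌋
    ≟-sym : ∀ x y → ⌊ x ≟ y ⌋ ≡ ⌊ y ≟ x ⌋
    ≟-sym x y with x ≟ y | y ≟ x
    ... | yes _ | yes _ = refl
    ... | no _ | no _ = refl
    ... | yes p | no q = Data.Empty.⊥-elim (q (sym p))
      where import Data.Empty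
    ... | no p | yes q = Data.Empty.⊥-elim (p (sym q))
      where import Data.Empty
    irr : ∀ v → ((isSucc v v ∨ isSucc v v) ∧ not ⌊ v ≟ v ⌋) ≡ false
    irr v with v ≟ v
    ... | yes _ = ∧-zeroʳ _
    ... | no ¬p = Data.Empty.⊥-elim (¬p refl)
      where import Data.Empty

ComponentIso : ∀ {N k} → Graph N → Fin N → Graph k → Set
ComponentIso {N} {k} F v H =
  Σ (Fin k → Fin N) λ f → Injective _≡_ _≡_ f
    × (∀ u → Reach F v u → Σ (Fin k) λ i → f i ≡ u)
    × (∀ i → Reach F v (f i))
    × (∀ i j → adj H i j ≡ adj F (f i) (f j))

-- The family {C_{2i+1} (2i+1 written suc (i + i)), T : 1 ≤ i < m/(n-m), T ∈ 𝒯_{n/m}}, with q = n/m and r = m/(n-m).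
InFamily : (q r : ℚ) → ∀ {k} → Graph k → Set
InFamily q r {k} H =
  (Σ ℕ λ i → Σ (1 ℕ.≤ i) λ 1≤i → ℕtoℚ i < r ×
     Σ (k ≡ suc (i ℕ.+ i)) λ eq → IsoGraph H (cycleGraph (suc (i ℕ.+ i)) (lem i 1≤i)))
  ⊎ InTq q H
  where
    lem : ∀ i → 1 ℕ.≤ i → 3 ℕ.≤ suc (i ℕ.+ i)
    lem i h = ℕ.s≤s (Data.Nat.Properties.+-mono-≤ h h)
      where import Data.Nat.Properties
    IsoGraph : ∀ {k k'} → Graph k → Graph k' → Set
    IsoGraph {k} {k'} A B = Σ (Fin k → Fin k') λ g → Injective _≡_ _≡_ g
      × (∀ y → Σ (Fin k) λ x → g x ≡ y) × (∀ x y → adj A x y ≡ adj B (g x) (g y))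

SpanningSub : ∀ {N} → Graph N → Graph N → Set
SpanningSub F G = ∀ u v → adj F u v ≡ true → adj G u v ≡ true

-- G has a 𝒢-factor where 𝒢 = InFamily q r (closed under isomorphism by the ∃ H ≅ component).
HasFamilyFactor : ∀ {N} → Graph N → (q r : ℚ) → Set
HasFamilyFactor {N} G q r =
  Σ (Graph N) λ F → SpanningSub F G ×
    (∀ v → Σ ℕ λ k → Σ (Graph k) λ H → InFamily q r H × ComponentIso F v H)

-- d^h(v) = Σ_{u adjacent to v} h(vu);  h : E(G) → ℚ represented as a symmetric
-- function on ordered pairs (only values on edges matter).
degh : ∀ {N} → Graph N → (Fin N → Fin N → ℚ) → Fin N → ℚ
degh G h v = foldr _+_ 0ℚ (map (λ u → if adj G v u then h v u else 0ℚ) (allFin _))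

IsFracFactor : ∀ {N} → Graph N → ℚ → ℚ → (Fin N → Fin N → ℚ) → Set
IsFracFactor G a b h =
  (∀ u v → h u v ≡ h v u)
  × (∀ u v → adj G u v ≡ true → (0ℚ ≤ h u v) × (h u v ≤ 1ℚ))
  × (∀ v → (a ≤ degh G h v) × (degh G h v ≤ b))

module Submission where

-- Scale all weights by m. Integral weights with degrees in [m , n] are found by augmentation along
-- alternating walks: a vertex of too small degree can be improved unless the walks from it alternate
-- between a set S of saturated vertices and vertices of degree at most m isolated by S, which
-- contradicts 1). As m < n, no parity obstruction arises, and entries above m can be cut down to m.
--
-- For 4), take a spanning subgraph F that satisfies 1) and is minimal for this. Then every factor
-- of F is positive on every edge, so no factor can be moved until an entry vanishes. An even cycle
-- carries an alternating weight with all degrees 0, along which one can move. Each vertex x of an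
-- odd cycle has a weight on the cycle with degree 2 at x and 0 elsewhere. This property spreads
-- along edges leaving the cycle; two such weights make a chord impossible, and one such weight makes
-- a leaf impossible. So an odd cycle has no edge leaving it and is a component of F. Its length is
-- bounded because a long odd cycle has a factor vanishing on one edge. All other components are
-- trees, critical because F is. Conversely, 1) for all components of F implies 1) for F.

open import Defs
open import Algebra.Bundles using (CommutativeSemigroup)
open import Algebra.Structures using (IsCommutativeMonoid)
open import Data.Bool using (Bool; true; false; not; _∧_; _∨_; if_then_else_)
open import Data.Fin using (Fin; zero; suc)
open import Data.Fin.Subset using (Subset; ∣_∣)
open import Data.List as List using (allFin)
open import Data.List.Properties using (map-tabulate)
open import Data.Nat as ℕ using (ℕ; zero; suc)
open import Data.Product using (Σ; ∃; _×_; _,_; proj₁; proj₂)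
open import Data.Vec using (lookup)
open import Function using (_∘_; id)
open import Level using (0ℓ)
open import Relation.Binary.PropositionalEquality
open import Relation.Binary.Structures using (IsPreorder)

-- The obstacle in building integral weights is that an alternating walk may meet the same vertex in
-- both roles, so that shifting the whole walk at once could push a degree out of range; for exact
-- degrees this leads to the odd-component conditions of factor theory. Here a walk is shifted from
-- its far end, one raised and one lowered edge at a time, and a vertex without excess has degree at
-- most m, hence room for one more unit below n. Moving a factor until an entry vanishes takes a
-- rational step. A common denominator L, carried along with each factor, absorbs it, so all
-- combinatorics stays in ℤ and ℚ appears only at the very end. The bound on i has this origin:
-- removing an edge from the cycle on 2i + 1 vertices leaves a path in which i alternate vertices
-- isolate the other i + 1. The path satisfies 1) exactly when (i + 1) m ≤ i n, so the edge is
-- indispensable exactly when i n < (i + 1) m, that is, i < m / (n - m).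

Iso : ∀ {N} → Graph N → (Fin N → Bool) → Fin N → Set
Iso G s v = s v ≡ false × (∀ u → adj G v u ≡ true → s u ≡ true)

foldr-∧⇒ : ∀ {N k} (g : Fin k → Fin N) (b : Fin N → Bool) →
  List.foldr (λ u c → b u ∧ c) true (List.tabulate g) ≡ true → ∀ i → b (g i) ≡ true
foldr-∧⇒ g b e zero with b (g zero)
... | true = refl
... | false = e
foldr-∧⇒ g b e (suc i) with b (g zero)
... | true = foldr-∧⇒ (g ∘ suc) b e i
foldr-∧⇒ g b () (suc i) | false

foldr-∧⇐ : ∀ {N k} (g : Fin k → Fin N) (b : Fin N → Bool) →
  (∀ i → b (g i) ≡ true) → List.foldr (λ u c → b u ∧ c) true (List.tabulate g) ≡ true
foldr-∧⇐ {k = zero} g b e = refl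
foldr-∧⇐ {k = suc k} g b e rewrite e zero = foldr-∧⇐ (g ∘ suc) b (e ∘ suc)

isolated⇒ : ∀ {N} (G : Graph N) S v → isIsolatedIn- G S v ≡ true → Iso G (lookup S) v
isolated⇒ {N} G S v e with lookup S v
... | false = refl , λ u a →
    impl (adj G v u) a (foldr-∧⇒ id (λ u → not (adj G v u) ∨ lookup S u) e u)
  where
  impl : ∀ x {y} → x ≡ true → not x ∨ y ≡ true → y ≡ true
  impl true _ q = q

isolated⇐ : ∀ {N} (G : Graph N) S v → Iso G (lookup S) v → isIsolatedIn- G S v ≡ true
isolated⇐ {N} G S v (s , t) rewrite s = foldr-∧⇐ id _ λ u → impl (adj G v u) (t u)
  where
  impl : ∀ x {y} → (x ≡ true → y ≡ true) → not x ∨ y ≡ true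
  impl true f = f refl
  impl false f = refl

-- Finite sums in an ordered commutative monoid, for use over ℤ and over ℚ

module OrderedSum {A : Set} {_+_ : A → A → A} {0# : A} (isCM : IsCommutativeMonoid _≡_ _+_ 0#)
  {_≤_ : A → A → Set} (isPre : IsPreorder _≡_ _≤_)
  (+-mono : ∀ {a b c d} → a ≤ b → c ≤ d → (a + c) ≤ (b + d)) where

  open IsCommutativeMonoid isCM using (identityˡ)
  semigroup : CommutativeSemigroup 0ℓ 0ℓ
  semigroup = record { isCommutativeSemigroup = IsCommutativeMonoid.isCommutativeSemigroup isCM }

  open import Algebra.Properties.CommutativeSemigroup semigroup using (interchange)
  open IsPreorder isPre using () renaming (refl to ≤-refl; trans to ≤-trans; reflexive to ≤-reflexive)

  sum : ∀ {k} → (Fin k → A) → A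
  sum {zero} f = 0#
  sum {suc k} f = f zero + sum (f ∘ suc)

  sum-cong : ∀ {k} {f g : Fin k → A} → (∀ i → f i ≡ g i) → sum f ≡ sum g
  sum-cong {zero} h = refl
  sum-cong {suc k} h = cong₂ _+_ (h zero) (sum-cong (h ∘ suc))

  sum-const-0 : ∀ k → sum {k} (λ _ → 0#) ≡ 0#
  sum-const-0 zero = refl
  sum-const-0 (suc k) = trans (identityˡ _) (sum-const-0 k)

  sum-+ : ∀ {k} (f g : Fin k → A) → sum (λ i → f i + g i) ≡ (sum f + sum g)
  sum-+ {zero} f g = sym (identityˡ 0#)
  sum-+ {suc k} f g = trans (cong ((f zero + g zero) +_) (sum-+ (f ∘ suc) (g ∘ suc)))
    (interchange (f zero) (g zero) (sum (f ∘ suc)) (sum (g ∘ suc)))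

  sum-swap : ∀ {j k} (f : Fin j → Fin k → A) →
    sum (λ a → sum (f a)) ≡ sum (λ b → sum (λ a → f a b))
  sum-swap {zero} {k} f = sym (sum-const-0 k)
  sum-swap {suc j} f = trans (cong (sum (f zero) +_) (sum-swap (f ∘ suc)))
    (sym (sum-+ (f zero) (λ b → sum (λ a → f (suc a) b))))

  sum-mono : ∀ {k} {f g : Fin k → A} → (∀ i → f i ≤ g i) → sum f ≤ sum g
  sum-mono {zero} h = ≤-refl
  sum-mono {suc k} h = +-mono (h zero) (sum-mono (h ∘ suc))

  foldr-allFin : ∀ {k} (f : Fin k → A) → List.foldr _+_ 0# (List.map f (allFin k)) ≡ sum f
  foldr-allFin {k} f = trans (cong (List.foldr _+_ 0#) (map-tabulate id f)) (go k f)
    where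
    go : ∀ k (f : Fin k → A) → List.foldr _+_ 0# (List.tabulate f) ≡ sum f
    go zero f = refl
    go (suc k) f = cong (f zero +_) (go k (f ∘ suc))

  pick : Bool → A → A
  pick b x = if b then x else 0#

  sum-pick : ∀ {k} b (f : Fin k → A) → pick b (sum f) ≡ sum (λ i → pick b (f i))
  sum-pick true f = refl
  sum-pick {k} false f = sym (sum-const-0 k)

  pick-mono : ∀ b {x y} → x ≤ y → pick b x ≤ pick b y
  pick-mono true p = p
  pick-mono false p = ≤-refl

  -- Double counting: every edge at an isolated vertex of G - S ends in S. So the weight of at least
  -- `a` at each such vertex is charged to S, where each vertex takes in at most `b`.
  isolated-bound : ∀ {N} (G : Graph N) (S : Subset N) (h : Fin N → Fin N → A) (a b : A) →
    (∀ u v → h u v ≡ h v u) → (∀ u v → adj G u v ≡ true → 0# ≤ h u v) →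
    (∀ v → a ≤ sum (λ u → pick (adj G v u) (h v u))) →
    (∀ v → sum (λ u → pick (adj G v u) (h v u)) ≤ b) →
    sum (λ v → pick (isIsolatedIn- G S v) a) ≤ sum (λ v → pick (lookup S v) b)
  isolated-bound {N} G S h a b h-sym h≥0 lower upper =
    ≤-trans (sum-mono λ v → pick-mono (iso v) (lower v))
    (≤-trans (≤-reflexive (sum-cong λ v → sum-pick (iso v) (λ u → e v u)))
    (≤-trans (sum-mono λ v → sum-mono λ u → charge v u)
    (≤-trans (≤-reflexive (trans (sum-swap λ v u → pick (lookup S u) (e v u))
      (sum-cong λ u → trans (sum-cong λ v → cong (pick (lookup S u)) (e-sym v u))
        (sym (sum-pick (lookup S u) (λ v → e u v))))))
    (sum-mono λ v → pick-mono (lookup S v) (upper v)))))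
    where
    iso = isIsolatedIn- G S
    e : Fin N → Fin N → A
    e v u = pick (adj G v u) (h v u)
    e-sym : ∀ v u → e v u ≡ e u v
    e-sym v u = cong₂ pick (adjSym G v u) (h-sym v u)
    e≥0 : ∀ v u → 0# ≤ e v u
    e≥0 v u with adj G v u in eq
    ... | true = h≥0 v u eq
    ... | false = ≤-refl
    pick≥0 : ∀ b {x} → 0# ≤ x → 0# ≤ pick b x
    pick≥0 true p = p
    pick≥0 false p = ≤-refl
    charge : ∀ v u → pick (iso v) (e v u) ≤ pick (lookup S u) (e v u)
    charge v u with iso v in i | adj G v u in eq
    ... | false | true = pick≥0 (lookup S u) (h≥0 v u eq)
    ... | false | false = pick≥0 (lookup S u) ≤-refl
    ... | true | true rewrite proj₂ (isolated⇒ G S v i) u eq = ≤-refl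
    ... | true | false = pick≥0 (lookup S u) ≤-refl

module Integral where

  open import Data.Bool.Properties using (T?) renaming (_≟_ to _≟ᵇ_)
  open import Data.Empty using (⊥; ⊥-elim)
  open import Data.Fin using (toℕ; _≟_)
  open import Data.Fin.Properties using (any?; all?; toℕ<n; toℕ-injective; toℕ-fromℕ<; suc-injective; injective⇒≤)
  open import Data.Fin.Subset using () renaming (⊥ to ∅)
  open import Data.Fin.Subset.Properties using (∣p∣≤n; anySubset?)
  open import Data.Integer hiding (suc; _≟_) renaming (∣_∣ to abs)
  open import Data.Integer.Properties hiding (_≟_)
  open import Data.Integer.Tactic.RingSolver using (solve-∀)
  open import Data.List using (List; []; _∷_; cartesianProduct)
  open import Data.List.Membership.Propositional.Properties using (∈-allFin; ∈-cartesianProduct⁺)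
  open import Data.List.Relation.Unary.All as All using (All; []; _∷_)
  import Data.Nat.Properties as ℕ
  open import Data.Nat.DivMod using (_mod_; m<n⇒m%n≡m; n%n≡0)
  open import Data.Rational using (ℚ; 0ℚ; 1ℚ)
  import Data.Rational as ℚ
  import Data.Rational.Properties as ℚ
  import Data.Rational.Unnormalised as ℚᵘ
  import Data.Rational.Unnormalised.Properties as ℚᵘ
  open import Data.Sum using (_⊎_; inj₁; inj₂; [_,_]′)
  open import Data.Vec using (tabulate; _[_]≔_; []; _∷_)
  open import Data.Vec.Properties using (lookup∘tabulate; lookup∘update; lookup∘update′)
  open import Function.Bundles using (_⇔_; mk⇔)
  open import Function.Definitions using (Injective)
  open import Relation.Binary.Definitions using (tri<; tri≈; tri>)
  open import Relation.Nullary using (¬_; Dec; yes; no)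
  open import Relation.Nullary.Decidable using (_×-dec_; _⊎-dec_; _→-dec_; map′; isYes)

  -- Edge weights and factors

  open OrderedSum +-0-isCommutativeMonoid ≤-isPreorder +-mono-≤ public

  ≤-by : ∀ {a b} z → 0ℤ ≤ z → b ≡ a + z → a ≤ b
  ≤-by {a} z p refl = subst (_≤ a + z) (+-identityʳ a) (+-monoʳ-≤ a p)

  +-≥0 : ∀ {a b} → 0ℤ ≤ a → 0ℤ ≤ b → 0ℤ ≤ a + b
  +-≥0 p q = +-mono-≤ p q

  *-≥0 : ∀ {a b} → 0ℤ ≤ a → 0ℤ ≤ b → 0ℤ ≤ a * b
  *-≥0 {+ a} {+ b} p q rewrite sym (pos-* a b) = +≤+ ℕ.z≤n

  *-monoˡ : ∀ {a b c} → 0ℤ ≤ a → b ≤ c → a * b ≤ a * c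
  *-monoˡ {+ a} p q = *-monoˡ-≤-nonNeg (+ a) q

  *-cancelˡ : ∀ {a b c} → 0ℤ < a → a * b ≤ a * c → b ≤ c
  *-cancelˡ {a} {b} {c} p q = *-cancelˡ-≤-pos b c a {{positive p}} q

  sum-*ˡ : ∀ {k} c (f : Fin k → ℤ) → sum (λ i → c * f i) ≡ c * sum f
  sum-*ˡ {zero} c f = sym (*-zeroʳ c)
  sum-*ˡ {suc k} c f = trans (cong (λ z → c * f zero + z) (sum-*ˡ c (f ∘ suc)))
      (sym (*-distribˡ-+ c _ _))

  sum-lin : ∀ {k} s t (f g : Fin k → ℤ) →
    sum (λ i → s * f i + t * g i) ≡ s * sum f + t * sum g
  sum-lin s t f g = trans (sum-+ (λ i → s * f i) (λ i → t * g i))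
    (cong₂ _+_ (sum-*ˡ s f) (sum-*ˡ t g))

  sum-zero : ∀ {k} {f : Fin k → ℤ} → (∀ i → f i ≡ 0ℤ) → sum f ≡ 0ℤ
  sum-zero {k} h = trans (sum-cong h) (sum-const-0 k)

  sum≥0 : ∀ {k} {f : Fin k → ℤ} → (∀ i → 0ℤ ≤ f i) → 0ℤ ≤ sum f
  sum≥0 {k} {f} h = subst (_≤ sum f) (sum-const-0 k) (sum-mono h)

  term≤sum : ∀ {k} {f : Fin k → ℤ} → (∀ i → 0ℤ ≤ f i) → ∀ i → f i ≤ sum f
  term≤sum {f = f} h zero = ≤-by _ (sum≥0 (h ∘ suc)) refl
  term≤sum {f = f} h (suc i) =
    ≤-trans (term≤sum (h ∘ suc) i) (≤-by (f zero) (h zero) (+-comm (f zero) _))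

  sum-mono-< : ∀ {k} {f g : Fin k → ℤ} → (∀ i → f i ≤ g i) → ∀ i → f i < g i → sum f < sum g
  sum-mono-< h zero p = +-mono-<-≤ p (sum-mono (h ∘ suc))
  sum-mono-< h (suc i) p = +-mono-≤-< (h zero) (sum-mono-< (h ∘ suc) i p)

  e : ∀ {N} → Fin N → Fin N → ℤ
  e u x with x ≟ u
  ... | yes _ = 1ℤ
  ... | no _ = 0ℤ

  e-same : ∀ {N} (u : Fin N) → e u u ≡ 1ℤ
  e-same u with u ≟ u
  ... | yes _ = refl
  ... | no ¬p = ⊥-elim (¬p refl)

  e-diff : ∀ {N} {u x : Fin N} → x ≢ u → e u x ≡ 0ℤ
  e-diff {u = u} {x} ne with x ≟ u
  ... | yes p = ⊥-elim (ne p)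
  ... | no _ = refl

  e≥0 : ∀ {N} (u x : Fin N) → 0ℤ ≤ e u x
  e≥0 u x with x ≟ u
  ... | yes _ = +≤+ ℕ.z≤n
  ... | no _ = ≤-refl

  e-suc : ∀ {N} (u x : Fin N) → e (suc u) (suc x) ≡ e u x
  e-suc u x = split (x ≟ u)
    where
    split : Dec (x ≡ u) → e (suc u) (suc x) ≡ e u x
    split (yes refl) = trans (e-same (suc u)) (sym (e-same u))
    split (no ne) = trans (e-diff λ { refl → ne refl }) (sym (e-diff ne))

  sum-e : ∀ {N} (u : Fin N) → sum (e u) ≡ 1ℤ
  sum-e {suc N} zero = cong (λ z → 1ℤ + z) (sum-zero {N} λ i → e-diff {u = zero} {suc i} λ ())
  sum-e (suc u) = trans (+-identityˡ _) (trans (sum-cong (e-suc u)) (sum-e u))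

  EdgeFun : ℕ → Set
  EdgeFun N = Fin N → Fin N → ℤ

  -- For u ≠ v, the symmetric indicator matrix of the edge uv. Written as a sum of products, it has
  -- its row sums by linearity, without a case distinction.
  E : ∀ {N} → Fin N → Fin N → EdgeFun N
  E u v a b = e u a * e v b + e v a * e u b

  lin : ∀ {N} → ℤ → EdgeFun N → ℤ → EdgeFun N → EdgeFun N
  lin s p t q a b = s * p a b + t * q a b

  δ : ∀ {N} → EdgeFun N → Fin N → ℤ
  δ p x = sum (p x)

  δ-lin : ∀ {N} s (p : EdgeFun N) t q x → δ (lin s p t q) x ≡ s * δ p x + t * δ q x
  δ-lin s p t q x = sum-lin s t (p x) (q x)

  δ-E : ∀ {N} (u v x : Fin N) → δ (E u v) x ≡ e u x + e v x
  δ-E u v x = trans (sum-lin (e u x) (e v x) (e v) (e u))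
    (cong₂ _+_ (trans (cong (e u x *_) (sum-e v)) (*-identityʳ (e u x)))
               (trans (cong (e v x *_) (sum-e u)) (*-identityʳ (e v x))))

  SamePair : ∀ {N} (u v a b : Fin N) → Set
  SamePair u v a b = (a ≡ u × b ≡ v) ⊎ (a ≡ v × b ≡ u)

  E-sym : ∀ {N} (u v a b : Fin N) → E u v a b ≡ E u v b a
  E-sym u v a b = (λ (p q r s : ℤ) → lemma p q r s) (e u a) (e v b) (e v a) (e u b)
    where
    lemma : ∀ p q r s → p * q + r * s ≡ s * r + q * p
    lemma = solve-∀

  E≥0 : ∀ {N} (u v a b : Fin N) → 0ℤ ≤ E u v a b
  E≥0 u v a b = +-≥0 (*-≥0 (e≥0 u a) (e≥0 v b)) (*-≥0 (e≥0 v a) (e≥0 u b))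

  e*e-off : ∀ {N} (u v a b : Fin N) → ¬ (a ≡ u × b ≡ v) → e u a * e v b ≡ 0ℤ
  e*e-off u v a b h with a ≟ u | b ≟ v
  ... | yes p | yes q = ⊥-elim (h (p , q))
  ... | yes p | no _ = refl
  ... | no _ | _ = refl

  E-off : ∀ {N} (u v a b : Fin N) → ¬ SamePair u v a b → E u v a b ≡ 0ℤ
  E-off u v a b h = cong₂ _+_ (e*e-off u v a b (h ∘ inj₁)) (e*e-off v u a b (h ∘ inj₂))

  E-on : ∀ {N} {u v : Fin N} → u ≢ v → E u v u v ≡ 1ℤ
  E-on {u = u} {v} ne = cong₂ _+_ (cong₂ _*_ (e-same u) (e-same v)) (cong (_* e u v) (e-diff ne))

  -- Vanishing off the edges is what lets the degree be the plain row sum `δ`, which is linear in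
  -- the weight and does not mention the graph.
  Weight : ∀ {N} → Graph N → EdgeFun N → Set
  Weight G p = (∀ a b → p a b ≡ p b a) × (∀ a b → adj G a b ≡ false → p a b ≡ 0ℤ)

  Weight-lin : ∀ {N} (G : Graph N) s p t q → Weight G p → Weight G q → Weight G (lin s p t q)
  Weight-lin G s p t q (ps , pz) (qs , qz) =
    (λ a b → cong₂ (λ x y → s * x + t * y) (ps a b) (qs a b)) ,
    (λ a b f → trans (cong₂ (λ x y → s * x + t * y) (pz a b f) (qz a b f))
      (cong₂ _+_ (*-zeroʳ s) (*-zeroʳ t)))

  true≢false : ∀ {b : Bool} → b ≡ true → b ≡ false → ⊥
  true≢false refl ()

  adj-flip : ∀ {N} (G : Graph N) {u v} → adj G u v ≡ true → adj G v u ≡ true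
  adj-flip G {u} {v} a = trans (adjSym G v u) a

  adj⇒≢ : ∀ {N} (G : Graph N) {u v} → adj G u v ≡ true → u ≢ v
  adj⇒≢ G a refl = true≢false a (adjIrr G _)

  Weight-E : ∀ {N} (G : Graph N) {u v} → adj G u v ≡ true → Weight G (E u v)
  Weight-E G {u} {v} uv = E-sym u v , λ a b f → E-off u v a b λ
    { (inj₁ (refl , refl)) → true≢false uv f
    ; (inj₂ (refl , refl)) → true≢false (adj-flip G uv) f }

  module Bounds (m n : ℤ) (0<m : 0ℤ < m) (m<n : m < n) where

    -- Statement 1) multiplied by m, with both cardinalities written as sums over all vertices, the
    -- form in which double counting delivers it.
    C1 : ∀ {N} → Graph N → Set
    C1 {N} G = ∀ (S : Subset N) →
      sum (λ v → pick (isIsolatedIn- G S v) m) ≤ sum (λ v → pick (lookup S v) n)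

    -- `L` is a common denominator: `h` divided by L m has its degrees between 1 and n / m. The
    -- bound 1 on the single entries is imposed only at the end, by cutting.
    record Factor {N} (G : Graph N) (L : ℤ) (h : EdgeFun N) : Set where
      field
        weight : Weight G h
        nonneg : ∀ a b → 0ℤ ≤ h a b
        lower  : ∀ v → L * m ≤ δ h v
        upper  : ∀ v → δ h v ≤ L * n

    open Factor public

    pick-* : ∀ b L x → pick b (L * x) ≡ L * pick b x
    pick-* true L x = refl
    pick-* false L x = sym (*-zeroʳ L)

    Factor⇒C1 : ∀ {N} {G : Graph N} {L h} → 0ℤ < L → Factor G L h → C1 G
    Factor⇒C1 {G = G} {L} {h} 0<L F S = *-cancelˡ 0<L (subst₂ _≤_
      (scale (isIsolatedIn- G S) m) (scale (lookup S) n)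
      (isolated-bound G S h (L * m) (L * n) (proj₁ (weight F)) (λ u v _ → nonneg F u v)
        (λ v → subst (L * m ≤_) (sym (degree v)) (lower F v))
        (λ v → subst (_≤ L * n) (sym (degree v)) (upper F v))))
      where
      scale : ∀ (b : Fin _ → Bool) x → sum (λ v → pick (b v) (L * x)) ≡ L * sum (λ v → pick (b v) x)
      scale b x = trans (sum-cong λ v → pick-* (b v) L x) (sum-*ˡ L (λ v → pick (b v) x))
      degree : ∀ v → sum (λ u → pick (adj G v u) (h v u)) ≡ δ h v
      degree v = sum-cong λ u → entry u
        where
        entry : ∀ u → pick (adj G v u) (h v u) ≡ h v u
        entry u with adj G v u in eq
        ... | true = refl
        ... | false = sym (proj₂ (weight F) v u eq)

  -- Augmentation along alternating walks

  isYes⇒ : ∀ {P : Set} (d : Dec P) → isYes d ≡ true → P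
  isYes⇒ (yes p) _ = p

  isYes⇐ : ∀ {P : Set} (d : Dec P) → P → isYes d ≡ true
  isYes⇐ (yes p) _ = refl
  isYes⇐ (no ¬p) p = ⊥-elim (¬p p)

  insert-size : ∀ {N} (X : Subset N) y → lookup X y ≡ false → ∣ X [ y ]≔ true ∣ ≡ suc ∣ X ∣
  insert-size (false ∷ X) zero refl = refl
  insert-size (true ∷ X) (suc y) p = cong suc (insert-size X y p)
  insert-size (false ∷ X) (suc y) p = insert-size X y p

  insert-⊆ : ∀ {N} (X : Subset N) y {x} → lookup X x ≡ true → lookup (X [ y ]≔ true) x ≡ true
  insert-⊆ X y {x} p with x ≟ y
  ... | yes refl = lookup∘update y X true
  ... | no ne = trans (lookup∘update′ ne X true) p

  insert-∈ : ∀ {N} (X : Subset N) y {x} → lookup (X [ y ]≔ true) x ≡ true →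
      x ≡ y ⊎ lookup X x ≡ true
  insert-∈ X y {x} p with x ≟ y
  ... | yes q = inj₁ q
  ... | no ne = inj₂ (trans (sym (lookup∘update′ ne X true)) p)

  record Closure {N} (R : Fin N → Fin N → Set) (P : Fin N → Set) (v : Fin N) : Set where
    field
      set    : Subset N
      start  : lookup set v ≡ true
      sound  : ∀ x → lookup set x ≡ true → P x
      closed : ∀ x y → lookup set x ≡ true → R x y → lookup set y ≡ true

  -- Vertices are added one at a time. The invariant that `fuel` plus the current size is at least N
  -- makes the fuel suffice. Each member carries its proof of `P`, for instance a walk from `v`.
  closure : ∀ {N} {R : Fin N → Fin N → Set} (R? : ∀ x y → Dec (R x y)) {P : Fin N → Set} →
    (∀ x y → P x → R x y → P y) → ∀ v → P v → Closure R P v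
  closure {N} {R} R? {P} onward v Pv =
    grow N (∅ [ v ]≔ true) (ℕ.m≤m+n N _) (lookup∘update v ∅ true)
      λ x p → [ (λ { refl → Pv }) , (λ q → ⊥-elim (true≢false q (lookup-∅ x))) ]′ (insert-∈ ∅ v p)
    where
    lookup-∅ : ∀ {k} (x : Fin k) → lookup ∅ x ≡ false
    lookup-∅ zero = refl
    lookup-∅ (suc x) = lookup-∅ x
    grow : ∀ fuel (X : Subset N) → N ℕ.≤ fuel ℕ.+ ∣ X ∣ → lookup X v ≡ true →
      (∀ x → lookup X x ≡ true → P x) → Closure R P v
    grow fuel X bound vX XP
      with any? (λ x → any? λ y → (lookup X x ≟ᵇ true) ×-dec (lookup X y ≟ᵇ false) ×-dec R? x y)
    ... | no none = record
      { set = X ; start = vX ; sound = XP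
      ; closed = λ x y xX xy → inside x y xX xy (lookup X y) refl }
      where
      inside : ∀ x y → lookup X x ≡ true → R x y → ∀ b → lookup X y ≡ b → lookup X y ≡ true
      inside x y xX xy true q = q
      inside x y xX xy false q = ⊥-elim (none (x , y , xX , q , xy))
    grow zero X bound vX XP | yes (x , y , xX , yX , xy) =
      ⊥-elim (ℕ.<⇒≱ (subst (ℕ._≤ N) (insert-size X y yX) (∣p∣≤n (X [ y ]≔ true))) bound)
    grow (suc fuel) X bound vX XP | yes (x , y , xX , yX , xy) =
      grow fuel (X [ y ]≔ true)
        (subst (N ℕ.≤_) (sym (trans (cong (fuel ℕ.+_) (insert-size X y yX)) (ℕ.+-suc fuel _)))
            bound)
        (insert-⊆ X y vX)
        λ z p → [ (λ { refl → onward x y (XP x xX) xy }) , XP z ]′ (insert-∈ X y p)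

  module Augment (m n : ℤ) (0<m : 0ℤ < m) (m<n : m < n) {N : ℕ} (G : Graph N) where

    open Bounds m n 0<m m<n

    -- The lower bounds depend on the vertex: `t` records the degrees already achieved, which an
    -- augmentation has to preserve.
    record Valid (t : Fin N → ℤ) (h : EdgeFun N) : Set where
      field
        weight : Weight G h
        nonneg : ∀ a b → 0ℤ ≤ h a b
        above  : ∀ v → t v ≤ δ h v
        below  : ∀ v → δ h v ≤ n

    +1≤ : ∀ {a b} → a < b → a + 1ℤ ≤ b
    +1≤ {a} {b} p = subst (_≤ b) (+-comm 1ℤ a) (i<j⇒suc[i]≤j p)

    <+1 : ∀ a → a < a + 1ℤ
    <+1 a = subst (a <_) (+-comm 1ℤ a) (suc[i]≤j⇒i<j ≤-refl)

    lin11 : ∀ (h p : EdgeFun N) a b → lin 1ℤ h 1ℤ p a b ≡ h a b + p a b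
    lin11 h p a b = cong₂ _+_ (*-identityˡ (h a b)) (*-identityˡ (p a b))

    δ-raise : ∀ (h : EdgeFun N) v u y → δ (lin 1ℤ h 1ℤ (E v u)) y ≡ δ h y + (e v y + e u y)
    δ-raise h v u y = trans (δ-lin 1ℤ h 1ℤ (E v u) y)
      (cong₂ _+_ (*-identityˡ (δ h y)) (trans (*-identityˡ (δ (E v u) y)) (δ-E v u y)))

    raise-gains : ∀ (h : EdgeFun N) {v u} → adj G v u ≡ true → δ h v < δ (lin 1ℤ h 1ℤ (E v u)) v
    raise-gains h {v} {u} vu = subst (δ h v <_)
      (sym (trans (δ-raise h v u v)
          (cong (λ z → δ h v + z) (cong₂ _+_ (e-same v) (e-diff (adj⇒≢ G vu))))))
      (<+1 (δ h v))

    raise : ∀ {t h v u} → Valid t h → adj G v u ≡ true → δ h v < n → δ h u < n →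
      Valid t (lin 1ℤ h 1ℤ (E v u))
    raise {t} {h} {v} {u} V vu v<n u<n = record
      { weight = Weight-lin G 1ℤ h 1ℤ (E v u) (V .weight) (Weight-E G vu)
      ; nonneg = λ a b → subst (0ℤ ≤_) (sym (lin11 h (E v u) a b))
          (+-≥0 (V .nonneg a b) (E≥0 v u a b))
      ; above = λ y → ≤-trans (V .above y)
          (≤-by (e v y + e u y) (+-≥0 (e≥0 v y) (e≥0 u y)) (δ-raise h v u y))
      ; below = λ y → subst (_≤ n) (sym (δ-raise h v u y)) (bound y) }
      where
      open Valid
      bound : ∀ y → δ h y + (e v y + e u y) ≤ n
      bound y with y ≟ v | y ≟ u
      ... | yes refl | yes refl = ⊥-elim (adj⇒≢ G vu refl)
      ... | yes refl | no _ = +1≤ v<n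
      ... | no _ | yes refl = +1≤ u<n
      ... | no _ | no _ = subst (_≤ n) (sym (+-identityʳ _)) (V .below y)

    module _ (t : Fin N → ℤ) (t≤m : ∀ v → t v ≤ m) (v₀ : Fin N) where

      open Valid

      -- Vertices reached from v₀ by alternating walks, whose odd steps are arbitrary edges (to be
      -- raised) and whose even steps are edges of positive weight (to be lowered).
      Lev : EdgeFun N → ℕ → Fin N → Set
      Lev h zero x = x ≡ v₀
      Lev h (suc k) x = Lev h k x ⊎ ∃ λ v → ∃ λ u → Lev h k v × adj G v u ≡ true × 0ℤ < h u x

      Lev? : ∀ h k x → Dec (Lev h k x)
      Lev? h zero x = x ≟ v₀
      Lev? h (suc k) x = Lev? h k x ⊎-dec
        any? λ v → any? λ u → Lev? h k v ×-dec (adj G v u ≟ᵇ true) ×-dec (0ℤ <? h u x)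

      Lev-mono : ∀ {h h'} → (∀ a b → h a b ≤ h' a b) → ∀ k {x} → Lev h k x → Lev h' k x
      Lev-mono le zero l = l
      Lev-mono le (suc k) (inj₁ l) = inj₁ (Lev-mono le k l)
      Lev-mono le (suc k) {x} (inj₂ (v , u , l , vu , pos)) =
        inj₂ (v , u , Lev-mono le k l , vu , <-≤-trans pos (le u x))

      Improved : Set
      Improved = ∃ λ h → Valid t h × t v₀ < δ h v₀

      raise-≥ : ∀ (h : EdgeFun N) v u a b → h a b ≤ lin 1ℤ h 1ℤ (E v u) a b
      raise-≥ h v u a b = ≤-by _ (E≥0 v u a b) (lin11 h (E v u) a b)

      -- The excess at `x` is handed back along the walk, one level at a time, until it arrives at
      -- `v₀`. A vertex with excess at a lower level is preferred. When there is none, all vertices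
      -- up to level k are tight, so they have degree at most m < n and the shift does not damage
      -- the remaining part of the walk.
      improve : ∀ k h → Valid t h → ∀ x → Lev h k x → t x < δ h x → Improved
      improve zero h V x refl ex = h , V , ex
      improve (suc k) h V x l ex with any? (λ y → Lev? h k y ×-dec (t y <? δ h y))
      ... | yes (y , ly , ey) = improve k h V y ly ey
      improve (suc k) h V x (inj₁ l) ex | no none = ⊥-elim (none (x , l , ex))
      improve (suc k) h V x (inj₂ (v , u , l , vu , pos)) ex | no none with δ h u <? n
      ... | yes u<n = improve k _ (raise V vu v<n u<n) v (Lev-mono (raise-≥ h v u) k l)
          (≤-<-trans (V .above v) (raise-gains h vu))
        where
        v<n : δ h v < n
        v<n = ≤-<-trans (≮⇒≥ λ p → none (v , l , p)) (≤-<-trans (t≤m v) m<n)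
      -- `u` has no room, so raising vu is paid for by lowering ux: the degree of `u` is unchanged,
      -- `x` gives up one unit of its excess and `v` gains it.
      ... | no u≮n = improve k h' V' v (transfer k (λ y ly ey → none (y , ly , ey)) l)
          (subst (t v <_) (sym δ'v) (≤-<-trans (V .above v) (<+1 (δ h v))))
        where
        v<n : δ h v < n
        v<n = ≤-<-trans (≮⇒≥ λ p → none (v , l , p)) (≤-<-trans (t≤m v) m<n)
        h' : EdgeFun N
        h' = lin 1ℤ (lin 1ℤ h 1ℤ (E v u)) -1ℤ (E u x)
        h'≡ : ∀ a b → h' a b ≡ h a b + E v u a b - E u x a b
        h'≡ a b = go (h a b) (E v u a b) (E u x a b)
          where
          go : ∀ p q r → 1ℤ * (1ℤ * p + 1ℤ * q) + -1ℤ * r ≡ p + q - r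
          go = solve-∀
        δ'≡ : ∀ y → δ h' y ≡ δ h y + e v y - e x y
        δ'≡ y = trans (δ-lin 1ℤ (lin 1ℤ h 1ℤ (E v u)) -1ℤ (E u x) y)
          (trans (cong₂ (λ p q → 1ℤ * p + -1ℤ * q) (δ-raise h v u y) (δ-E u x y))
            (go (δ h y) (e v y) (e u y) (e x y)))
          where
          go : ∀ p q r s → 1ℤ * (p + (q + r)) + -1ℤ * (r + s) ≡ p + q - s
          go = solve-∀
        ux : adj G u x ≡ true
        ux with adj G u x in eq
        ... | true = refl
        ... | false = ⊥-elim (<-irrefl (sym (proj₂ (V .weight) u x eq)) pos)
        x≢v : x ≢ v
        x≢v refl = none (v , l , ex)
        δ'v : δ h' v ≡ δ h v + 1ℤ
        δ'v = trans (δ'≡ v) (trans (cong₂ (λ p q → δ h v + p - q) (e-same v) (e-diff (x≢v ∘ sym)))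
          (+-identityʳ _))
        h'≥ : ∀ a b → ¬ SamePair u x a b → h a b ≤ h' a b
        h'≥ a b ne = ≤-by _ (E≥0 v u a b)
          (trans (h'≡ a b) (trans (cong (λ z → h a b + E v u a b - z) (E-off u x a b ne))
              (+-identityʳ _)))
        V' : Valid t h'
        V' = record
          { weight = Weight-lin G 1ℤ (lin 1ℤ h 1ℤ (E v u)) -1ℤ (E u x)
              (Weight-lin G 1ℤ h 1ℤ (E v u) (V .weight) (Weight-E G vu)) (Weight-E G ux)
          ; nonneg = nonneg'
          ; above = λ y → subst (t y ≤_) (sym (δ'≡ y)) (above' y)
          ; below = λ y → subst (_≤ n) (sym (δ'≡ y)) (below' y) }
          where
          ux-pos : 0ℤ ≤ h u x + E v u u x - E u x u x
          ux-pos = subst (λ z → 0ℤ ≤ h u x + E v u u x - z) (sym (E-on (adj⇒≢ G ux)))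
            (i≤j⇒0≤j-i (≤-trans (i<j⇒suc[i]≤j pos) (≤-by _ (E≥0 v u u x) refl)))
          nonneg' : ∀ a b → 0ℤ ≤ h' a b
          nonneg' a b = split ((a ≟ u ×-dec b ≟ x) ⊎-dec (a ≟ x ×-dec b ≟ u))
            where
            split : Dec (SamePair u x a b) → 0ℤ ≤ h' a b
            split (yes (inj₁ (refl , refl))) = subst (0ℤ ≤_) (sym (h'≡ u x)) ux-pos
            split (yes (inj₂ (refl , refl))) = subst (0ℤ ≤_)
              (sym (trans (h'≡ x u)
                  (cong₂ _-_ (cong₂ _+_ (proj₁ (V .weight) x u) (E-sym v u x u)) (E-sym u x x u))))
              ux-pos
            split (no ne) = ≤-trans (V .nonneg a b) (h'≥ a b ne)
          above' : ∀ y → t y ≤ δ h y + e v y - e x y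
          above' y with y ≟ x
          ... | no _ = ≤-trans (V .above y) (≤-by (e v y) (e≥0 v y) (+-identityʳ (δ h y + e v y)))
          ... | yes refl = 0≤i-j⇒j≤i (subst (0ℤ ≤_) (go (δ h y) (e v y) (t y))
              (+-≥0 (i≤j⇒0≤j-i (+1≤ ex)) (e≥0 v y)))
            where
            go : ∀ p q r → p - (r + 1ℤ) + q ≡ p + q - 1ℤ - r
            go = solve-∀
          below' : ∀ y → δ h y + e v y - e x y ≤ n
          below' y = ≤-trans (≤-by (e x y) (e≥0 x y) (go (δ h y + e v y) (e x y))) (top (y ≟ v))
            where
            go : ∀ p q → p ≡ p - q + q
            go = solve-∀
            top : Dec (y ≡ v) → δ h y + e v y ≤ n
            top (yes refl) = subst (λ z → δ h v + z ≤ n) (sym (e-same v)) (+1≤ v<n)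
            top (no ne) = subst (_≤ n)
                (sym (trans (cong (λ z → δ h y + z) (e-diff ne)) (+-identityʳ (δ h y))))
                    (V .below y)
        -- Low levels survive the shift: the only decreased edge {u , x} joins a vertex of
        -- degree n to a vertex with excess, and neither lies in a level without excess.
        transfer : ∀ j → (∀ y → Lev h j y → ¬ t y < δ h y) → ∀ {y} → Lev h j y → Lev h' j y
        transfer zero _ l = l
        transfer (suc j) no-ex (inj₁ l) = inj₁ (transfer j (λ y → no-ex y ∘ inj₁) l)
        transfer (suc j) no-ex {y} ly@(inj₂ (v' , u' , l , vu' , pos')) =
          inj₂ (v' , u' , transfer j (λ y → no-ex y ∘ inj₁) l , vu' , <-≤-trans pos' (h'≥ u' y λ
            { (inj₁ (_ , refl)) → no-ex y ly ex
            ; (inj₂ (_ , refl)) → u≮n (≤-<-trans (≮⇒≥ (no-ex y ly)) (≤-<-trans (t≤m y) m<n)) }))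

      -- The neighbourhood S of D violates (C1): S has n |S| units of weight, all of which
      -- end in D, where the degrees are at most m and not all equal to m.
      stuck : C1 G → ∀ {h} → Valid t h → t v₀ < m → (D : Subset N) → lookup D v₀ ≡ true →
        (∀ x u y → lookup D x ≡ true → adj G x u ≡ true → 0ℤ < h u y → lookup D y ≡ true) →
        (∀ x → lookup D x ≡ true → δ h x ≤ t x) →
        (∀ x u → lookup D x ≡ true → adj G x u ≡ true → n ≤ δ h u) → ⊥
      stuck c1 {h} V t<m D v₀D closed tight full = <-irrefl refl
        (≤-<-trans S≤D (<-≤-trans D<m (≤-trans D≤iso (c1 S))))
        where
        in-S? : ∀ u → Dec (∃ λ x → lookup D x ≡ true × adj G x u ≡ true)
        in-S? u = any? λ x → (lookup D x ≟ᵇ true) ×-dec (adj G x u ≟ᵇ true)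
        S : Subset N
        S = tabulate λ u → isYes (in-S? u)
        S⇒ : ∀ u → lookup S u ≡ true → ∃ λ x → lookup D x ≡ true × adj G x u ≡ true
        S⇒ u p = isYes⇒ (in-S? u) (trans (sym (lookup∘tabulate _ u)) p)
        S⇐ : ∀ u x → lookup D x ≡ true → adj G x u ≡ true → lookup S u ≡ true
        S⇐ u x d a = trans (lookup∘tabulate _ u) (isYes⇐ (in-S? u) (x , d , a))
        iso = isIsolatedIn- G S
        D⇒iso : ∀ x → lookup D x ≡ true → iso x ≡ true
        D⇒iso x d = isolated⇐ G S x (out (lookup S x) refl , λ u a → S⇐ u x d a)
          where
          out : ∀ b → lookup S x ≡ b → lookup S x ≡ false
          out false p = p
          -- A vertex in both S and D would have degree at least n and at most m.
          out true p with S⇒ x p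
          ... | y , yD , yx = ⊥-elim
              (<⇒≱ m<n (≤-trans (full y x yD yx) (≤-trans (tight x d) (t≤m x))))
        D≤iso : sum (λ x → pick (lookup D x) m) ≤ sum (λ x → pick (iso x) m)
        D≤iso = sum-mono λ x → le x (lookup D x) refl
          where
          le : ∀ x b → lookup D x ≡ b → pick b m ≤ pick (iso x) m
          le x true d rewrite D⇒iso x d = ≤-refl
          le x false d with iso x
          ... | true = <⇒≤ 0<m
          ... | false = ≤-refl
        D<m : sum (λ x → pick (lookup D x) (δ h x)) < sum (λ x → pick (lookup D x) m)
        D<m = sum-mono-< (λ x → le x (lookup D x) refl) v₀ strict
          where
          le : ∀ x b → lookup D x ≡ b → pick b (δ h x) ≤ pick b m
          le x true d = ≤-trans (tight x d) (t≤m x)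
          le x false d = ≤-refl
          strict : pick (lookup D v₀) (δ h v₀) < pick (lookup D v₀) m
          strict rewrite v₀D = ≤-<-trans (tight v₀ v₀D) t<m
        S≤D : sum (λ u → pick (lookup S u) n) ≤ sum (λ x → pick (lookup D x) (δ h x))
        S≤D = ≤-trans (sum-mono λ u → charge u (lookup S u) refl)
          (≤-reflexive (trans (sum-swap λ u y → pick (lookup D y) (h u y))
            (sum-cong λ y → trans (sum-cong λ u → cong (pick (lookup D y)) (proj₁ (V .weight) u y))
              (sym (sum-pick (lookup D y) (h y))))))
          where
          pick≥0 : ∀ b {z} → 0ℤ ≤ z → 0ℤ ≤ pick b z
          pick≥0 true p = p
          pick≥0 false p = ≤-refl
          charge : ∀ u b → lookup S u ≡ b → pick b n ≤ sum (λ y → pick (lookup D y) (h u y))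
          charge u false p = sum≥0 λ y → pick≥0 (lookup D y) (V .nonneg u y)
          charge u true p with S⇒ u p
          ... | x , xD , xu = ≤-trans (full x u xD xu) (sum-mono λ y → le y (lookup D y) refl)
            where
            le : ∀ y b → lookup D y ≡ b → h u y ≤ pick b (h u y)
            le y true q = ≤-refl
            le y false q = ≮⇒≥ λ pos → true≢false (closed x u y xD xu pos) q

      -- D consists of all vertices reachable by alternating walks. A vertex of D with excess can
      -- hand it back to `v₀`; an unsaturated neighbour of D allows an edge to be raised, which
      -- creates such an excess. If neither exists, `stuck` applies to D.
      augment : C1 G → ∀ {h} → Valid t h → t v₀ < m → Improved
      augment c1 {h} V t<m
        with closure {R = λ x y → ∃ λ u → adj G x u ≡ true × 0ℤ < h u y}
          (λ x y → any? λ u → (adj G x u ≟ᵇ true) ×-dec (0ℤ <? h u y))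
          {P = λ x → ∃ λ k → Lev h k x}
          (λ { x y (k , l) (u , xu , pos) → suc k , inj₂ (x , u , l , xu , pos) }) v₀ (0 , refl)
      ... | record { set = D ; start = v₀D ; sound = reach ; closed = closed }
        with any? (λ x → (lookup D x ≟ᵇ true) ×-dec (t x <? δ h x))
      ... | yes (x , d , ex) = improve (proj₁ (reach x d)) h V x (proj₂ (reach x d)) ex
      ... | no tight
        with any? (λ x → any? λ u →
            (lookup D x ≟ᵇ true) ×-dec (adj G x u ≟ᵇ true) ×-dec (δ h u <? n))
      ... | yes (x , u , d , xu , u<n) =
        improve (proj₁ (reach x d)) _
          (raise V xu (≤-<-trans (≮⇒≥ λ p → tight (x , d , p)) (≤-<-trans (t≤m x) m<n)) u<n) x
          (Lev-mono (raise-≥ h x u) (proj₁ (reach x d)) (proj₂ (reach x d)))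
          (≤-<-trans (V .above x) (raise-gains h xu))
      ... | no full = ⊥-elim (stuck c1 V t<m D v₀D
        (λ x u y d xu pos → closed x y d (u , xu , pos))
        (λ x d → ≮⇒≥ λ p → tight (x , d , p))
        (λ x u d xu → ≮⇒≥ λ p → full (x , u , d , xu , p)))

    module _ (c1 : C1 G) where

      open Valid

      Partial : EdgeFun N → Set
      Partial = Valid (λ _ → 0ℤ)

      -- The bound min (δ h y, m) protects a degree up to m and releases only what lies above m. So
      -- no saturated vertex is lost, and the deficit of `v`, which is at most `k`, drops in each
      -- round.
      saturate : ∀ v k {h} → Partial h → m ≤ δ h v + + k →
        ∃ λ h' → Partial h' × m ≤ δ h' v × (∀ y → m ≤ δ h y → m ≤ δ h' y)
      saturate v k {h} V gap with δ h v <? m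
      ... | no ≮m = h , V , ≮⇒≥ ≮m , λ y p → p
      saturate v zero {h} V gap | yes <m =
        ⊥-elim (<⇒≱ <m (subst (m ≤_) (+-identityʳ _) gap))
      saturate v (suc k) {h} V gap | yes <m
        with augment (λ y → δ h y ⊓ m) (λ y → i⊓j≤j (δ h y) m) v c1
          (record { weight = V .weight ; nonneg = V .nonneg
                  ; above = λ y → i⊓j≤i (δ h y) m ; below = V .below })
          (≤-<-trans (i⊓j≤i (δ h v) m) <m)
      ... | h' , V' , more
        with saturate v k {h'}
          (record { weight = V' .weight ; nonneg = V' .nonneg
                  ; above = λ y → sum≥0 (V' .nonneg y) ; below = V' .below })
          (≤-trans gap (subst (_≤ δ h' v + + k) (onward (δ h v) (+ k))
            (+-monoˡ-≤ (+ k) (i<j⇒suc[i]≤j (subst (_< δ h' v) (i≤j⇒i⊓j≡i (<⇒≤ <m)) more)))))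
        where
        onward : ∀ a b → 1ℤ + a + b ≡ a + (1ℤ + b)
        onward = solve-∀
      ... | h'' , V'' , done , keep = h'' , V'' , done ,
        λ y p → keep y (subst (_≤ δ h' y) (i≥j⇒i⊓j≡j p) (V' .above y))

      saturate-all : (vs : List (Fin N)) → ∃ λ h → Partial h × All (λ v → m ≤ δ h v) vs
      saturate-all [] = (λ _ _ → 0ℤ) , record
        { weight = (λ _ _ → refl) , (λ _ _ _ → refl) ; nonneg = λ _ _ → ≤-refl
        ; above = λ v → ≤-reflexive (sym (sum-const-0 N))
        ; below = λ v → subst (_≤ n) (sym (sum-const-0 N)) (<⇒≤ (<-trans 0<m m<n)) } , []
      saturate-all (v ∷ vs) with saturate-all vs
      ... | h , V , ok with saturate v (abs m) V
          (subst (_≤ δ h v + + (abs m)) (trans (+-identityˡ _) (0≤i⇒+∣i∣≡i (<⇒≤ 0<m)))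
            (+-monoˡ-≤ (+ (abs m)) (V .above v)))
      ... | h' , V' , done , keep = h' , V' , done ∷ All.map (λ {y} → keep y) ok

      C1⇒Factor : ∃ λ h → Factor G 1ℤ h
      C1⇒Factor with saturate-all (allFin N)
      ... | h , V , ok = h , record
        { weight = V .weight ; nonneg = V .nonneg
        ; lower = λ v → subst (_≤ δ h v) (sym (*-identityˡ m)) (All.lookup ok (∈-allFin v))
        ; upper = λ v → subst (δ h v ≤_) (sym (*-identityˡ n)) (V .below v) }

  -- Edge-critical graphs

  sum-single : ∀ {k} (f : Fin k → ℤ) y → (∀ u → u ≢ y → f u ≡ 0ℤ) → sum f ≡ f y
  sum-single f y off = trans (sum-cong pointwise)
    (trans (sum-*ˡ (f y) (e y)) (trans (cong (f y *_) (sum-e y)) (*-identityʳ (f y))))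
    where
    pointwise : ∀ u → f u ≡ f y * e y u
    pointwise u with u ≟ y
    ... | yes refl = sym (*-identityʳ (f y))
    ... | no ne = trans (off u ne) (sym (*-zeroʳ (f y)))

  samePair? : ∀ {N} (u v a b : Fin N) → Dec (SamePair u v a b)
  samePair? u v a b = (a ≟ u ×-dec b ≟ v) ⊎-dec (a ≟ v ×-dec b ≟ u)

  module _ {N : ℕ} (G : Graph N) (a b : Fin N) where

    deleteEdge-⊆ : SpanningSub (deleteEdge G a b) G
    deleteEdge-⊆ x y p with adj G x y
    ... | true = refl
    deleteEdge-⊆ x y () | false

    deleteEdge-off : ∀ {x y} → SamePair a b x y → adj (deleteEdge G a b) x y ≡ false
    deleteEdge-off {x} {y} s with adj G x y
    ... | false = refl
    deleteEdge-off {x} {y} s | true with x ≟ a | y ≟ b | y ≟ a | x ≟ b | s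
    ... | yes _ | yes _ | _ | _ | _ = refl
    ... | yes _ | no _ | yes _ | yes _ | _ = refl
    ... | no _ | _ | yes _ | yes _ | _ = refl
    ... | no ne | _ | _ | _ | inj₁ (p , _) = ⊥-elim (ne p)
    ... | yes _ | no ne | _ | _ | inj₁ (_ , p) = ⊥-elim (ne p)
    ... | no _ | _ | no ne | _ | inj₂ (_ , p) = ⊥-elim (ne p)
    ... | no _ | _ | yes _ | no ne | inj₂ (p , _) = ⊥-elim (ne p)
    ... | yes _ | no _ | no ne | _ | inj₂ (_ , p) = ⊥-elim (ne p)
    ... | yes _ | no _ | yes _ | no ne | inj₂ (p , _) = ⊥-elim (ne p)

    deleteEdge-on : ∀ {x y} → ¬ SamePair a b x y → adj (deleteEdge G a b) x y ≡ adj G x y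
    deleteEdge-on {x} {y} ns with adj G x y
    ... | false = refl
    deleteEdge-on {x} {y} ns | true with x ≟ a | y ≟ b | y ≟ a | x ≟ b
    ... | yes p | yes q | _ | _ = ⊥-elim (ns (inj₁ (p , q)))
    ... | _ | _ | yes q | yes p = ⊥-elim (ns (inj₂ (p , q)))
    ... | no _ | _ | no _ | _ = refl
    ... | no _ | _ | yes _ | no _ = refl
    ... | yes _ | no _ | no _ | _ = refl
    ... | yes _ | no _ | yes _ | no _ = refl

    Weight-delete : ∀ {p} → Weight G p → p a b ≡ 0ℤ → Weight (deleteEdge G a b) p
    Weight-delete {p} (ps , pz) ab = ps , λ x y f → split x y f (samePair? a b x y)
      where
      split : ∀ x y → adj (deleteEdge G a b) x y ≡ false → Dec (SamePair a b x y) → p x y ≡ 0ℤ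
      split x y f (yes (inj₁ (refl , refl))) = ab
      split x y f (yes (inj₂ (refl , refl))) = trans (ps x y) ab
      split x y f (no ns) = pz x y (trans (sym (deleteEdge-on ns)) f)

  deleteEdge-mono : ∀ {N} {F G : Graph N} a b → SpanningSub F G →
    SpanningSub (deleteEdge F a b) (deleteEdge G a b)
  deleteEdge-mono {F = F} {G} a b sub x y p with samePair? a b x y
  ... | yes s = ⊥-elim (true≢false p (deleteEdge-off F a b s))
  ... | no ns = trans (deleteEdge-on G a b ns) (sub x y (deleteEdge-⊆ F a b x y p))

  isolated-mono : ∀ {N} {F G : Graph N} → SpanningSub F G → ∀ S v →
    isIsolatedIn- G S v ≡ true → isIsolatedIn- F S v ≡ true
  isolated-mono {F = F} {G} sub S v i with isolated⇒ G S v i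
  ... | out , nbrs = isolated⇐ F S v (out , λ u a → nbrs u (sub v u a))

  module _ {A : Set} (h q : A → ℤ) where

    -- h y / q y is least among the ratios with positive denominator.
    least-ratio : (xs : List A) → ∀ x → 0ℤ < q x →
      ∃ λ y → 0ℤ < q y × All (λ z → 0ℤ < q z → h y * q z ≤ h z * q y) (x ∷ xs)
    least-ratio [] x 0<x = x , 0<x , (λ _ → ≤-refl) ∷ []
    least-ratio (z ∷ zs) x 0<x with least-ratio zs x 0<x
    ... | y , 0<y , yx ∷ yzs with 0ℤ <? q z | h z * q y <? h y * q z
    ... | no ¬0<z | _ = y , 0<y , yx ∷ (λ p → ⊥-elim (¬0<z p)) ∷ yzs
    ... | yes _ | no ≮ = y , 0<y , yx ∷ (λ _ → ≮⇒≥ ≮) ∷ yzs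
    ... | yes 0<z | yes lt = z , 0<z , via x yx ∷ (λ _ → ≤-refl) ∷ All.map (λ {w} → via w) yzs
      where
      rotate : ∀ a b c → a * (b * c) ≡ c * (b * a)
      rotate = solve-∀
      via : ∀ w → (0ℤ < q w → h y * q w ≤ h w * q y) → 0ℤ < q w → h z * q w ≤ h w * q z
      via w yw 0<w = *-cancelˡ 0<y
          (subst₂ _≤_ (rotate (q w) (h z) (q y)) (rotate (q z) (h w) (q y)) (≤-trans
        (*-monoˡ (<⇒≤ 0<w) (<⇒≤ lt))
        (subst (_≤ q z * (h w * q y)) (rotate (q z) (h y) (q w)) (*-monoˡ (<⇒≤ 0<z) (yw 0<w)))))

  module Minimal (m n : ℤ) (0<m : 0ℤ < m) (m<n : m < n) where

    open Bounds m n 0<m m<n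

    Violates : ∀ {N} → Graph N → Subset N → Set
    Violates G S = sum (λ v → pick (lookup S v) n) < sum (λ v → pick (isIsolatedIn- G S v) m)

    isolated-sum-mono : ∀ {N} {F G : Graph N} → SpanningSub F G → ∀ S →
      sum (λ v → pick (isIsolatedIn- G S v) m) ≤ sum (λ v → pick (isIsolatedIn- F S v) m)
    isolated-sum-mono {F = F} {G} sub S = sum-mono λ v → le v (isIsolatedIn- G S v) refl
      where
      le : ∀ v b → isIsolatedIn- G S v ≡ b → pick b m ≤ pick (isIsolatedIn- F S v) m
      le v true i rewrite isolated-mono {F = F} {G} sub S v i = ≤-refl
      le v false i with isIsolatedIn- F S v
      ... | true = <⇒≤ 0<m
      ... | false = ≤-refl

    C1-mono : ∀ {N} {F G : Graph N} → SpanningSub F G → C1 F → C1 G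
    C1-mono {F = F} {G} sub c1 S = ≤-trans (isolated-sum-mono {F = F} {G} sub S) (c1 S)

    Violable : ∀ {N} → Graph N → Set
    Violable G = ∃ (Violates G)

    violable? : ∀ {N} (G : Graph N) → Dec (Violable G)
    violable? G = anySubset? λ S → _ <? _

    ¬Violable⇒C1 : ∀ {N} {G : Graph N} → ¬ Violable G → C1 G
    ¬Violable⇒C1 nv S = ≮⇒≥ λ p → nv (S , p)

    Violable-mono : ∀ {N} {F G : Graph N} → SpanningSub F G → Violable G → Violable F
    Violable-mono {F = F} {G} sub (S , p) = S , <-≤-trans p (isolated-sum-mono {F = F} {G} sub S)

    Critical : ∀ {N} → Graph N → Set
    Critical F = C1 F × (∀ a b → adj F a b ≡ true → Violable (deleteEdge F a b))

    -- One pass over the pairs suffices: deleting further edges can only create isolated vertices,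
    -- so an edge once found indispensable remains so.
    prune : ∀ {N} (G : Graph N) → C1 G → (es : List (Fin N × Fin N)) → ∃ λ F →
        SpanningSub F G × C1 F ×
      All (λ { (a , b) → adj F a b ≡ true → Violable (deleteEdge F a b) }) es
    prune G c1 [] = G , (λ _ _ p → p) , c1 , []
    prune G c1 ((a , b) ∷ es) with prune G c1 es
    ... | F , sub , c1F , crit with violable? (deleteEdge F a b)
    ... | yes v = F , sub , c1F , (λ _ → v) ∷ crit
    ... | no nv = F' , (λ x y p → sub x y (F'⊆F x y p)) , ¬Violable⇒C1 {G = F'} nv ,
      (λ p → ⊥-elim (true≢false p (deleteEdge-off F a b (inj₁ (refl , refl))))) ∷
      All.map (λ {e} c p → Violable-mono {F = deleteEdge F' (proj₁ e) (proj₂ e)}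
          {deleteEdge F (proj₁ e) (proj₂ e)}
        (deleteEdge-mono {F = F'} {F} (proj₁ e) (proj₂ e) F'⊆F) (c (F'⊆F _ _ p))) crit
      where
      F' = deleteEdge F a b
      F'⊆F = deleteEdge-⊆ F a b

    critical-subgraph : ∀ {N} (G : Graph N) → C1 G → ∃ λ F → SpanningSub F G × Critical F
    critical-subgraph {N} G c1 with prune G c1 (cartesianProduct (allFin N) (allFin N))
    ... | F , sub , c1F , crit = F , sub , c1F , λ a b → All.lookup crit
      (∈-cartesianProduct⁺ (∈-allFin a) (∈-allFin b))

    -- Moving factors of a critical graph

    module Pushing {N : ℕ} (F : Graph N) (critical : Critical F) where

      -- A factor vanishing on ab is also a factor of F without ab, which by double counting would
      -- then satisfy `C1`, against criticality.
      full-support : ∀ {L h} → 0ℤ < L → Factor F L h → ∀ a b → adj F a b ≡ true → h a b ≢ 0ℤ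
      full-support {L} {h} 0<L H a b ab zero-ab with proj₂ critical a b ab
      ... | S , v = <⇒≱ v (Factor⇒C1 {G = deleteEdge F a b} 0<L (record
        { weight = Weight-delete F a b (H .weight) zero-ab
        ; nonneg = H .nonneg ; lower = H .lower ; upper = H .upper }) S)

      Leaf : Fin N → Fin N → Set
      Leaf x y = adj F x y ≡ true × (∀ u → adj F x u ≡ true → u ≡ y)

      δ-leaf : ∀ {x y} → Leaf x y → ∀ {p} → Weight F p → δ p x ≡ p x y
      δ-leaf {x} {y} (_ , only) {p} W = sum-single (p x) y λ u ne →
          proj₂ W x u (off u ne (adj F x u) refl)
        where
        off : ∀ u → u ≢ y → ∀ b → adj F x u ≡ b → adj F x u ≡ false
        off u ne true q = ⊥-elim (ne (only u q))
        off u ne false q = q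

      -- No degree bound at `x` stops a move in the direction `p`: either the degree is constant, or
      -- it grows at a leaf whose neighbour has constant degree.
      Unbounded : EdgeFun N → Fin N → Set
      Unbounded p x = δ p x ≡ 0ℤ ⊎ (0ℤ ≤ δ p x × ∃ λ y → Leaf x y × δ p y ≡ 0ℤ)

      -- Moving a factor in the direction p until its first entry vanishes keeps all degrees
      -- in range; at a leaf the degree is bounded by the degree of the neighbour.
      push : ∀ {p} → Weight F p → (∀ x → Unbounded p x) → ∀ a b → p a b < 0ℤ → ⊥
      push {p} W unb a₀ b₀ neg
        with Augment.C1⇒Factor m n 0<m m<n F (proj₁ critical)
      ... | h , H
        with least-ratio {Fin N × Fin N} (λ { (x , y) → h x y }) (λ { (x , y) → - p x y })
          (cartesianProduct (allFin N) (allFin N)) (a₀ , b₀) (neg-mono-< neg)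
      ... | (a , b) , 0<s , _ ∷ least = full-support 0<s H' a b ab zero-ab
        where
        -- The ratio t / s is the step length at which ab becomes the first entry to vanish.
        -- Multiplying h + (t / s) p by s avoids the division and yields a factor with denominator
        -- s.
        s = - p a b
        t = h a b
        h' : EdgeFun N
        h' = lin s h t p
        W' : Weight F h'
        W' = Weight-lin F s h t p (H .weight) W
        p<0 : p a b < 0ℤ
        p<0 = neg-cancel-< 0<s
        ab : adj F a b ≡ true
        ab with adj F a b in eq
        ... | true = refl
        ... | false = ⊥-elim (<-irrefl (proj₂ W a b eq) p<0)
        zero-ab : h' a b ≡ 0ℤ
        zero-ab = go (p a b) (h a b)
          where
          go : ∀ x y → - x * y + y * x ≡ 0ℤ
          go = solve-∀
        0≤t : 0ℤ ≤ t
        0≤t = H .nonneg a b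
        h'≥0 : ∀ x y → 0ℤ ≤ h' x y
        h'≥0 x y with p x y <? 0ℤ
        ... | no ≮ = +-≥0 (*-≥0 (<⇒≤ 0<s) (H .nonneg x y)) (*-≥0 0≤t (≮⇒≥ ≮))
        ... | yes lt = subst (0ℤ ≤_) (go (p a b) (p x y) (h a b) (h x y))
          (i≤j⇒0≤j-i (All.lookup least (∈-cartesianProduct⁺ (∈-allFin x) (∈-allFin y))
              (neg-mono-< lt)))
          where
          go : ∀ p q g h → h * - p - g * - q ≡ - p * h + g * q
          go = solve-∀
        δ≡ : ∀ x → δ h' x ≡ s * δ h x + t * δ p x
        δ≡ x = δ-lin s h t p x
        δ-fixed : ∀ x → δ p x ≡ 0ℤ → δ h' x ≡ s * δ h x
        δ-fixed x z = trans (δ≡ x) (trans (cong (λ w → s * δ h x + t * w) z)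
          (trans (cong (λ w → s * δ h x + w) (*-zeroʳ t)) (+-identityʳ (s * δ h x))))
        m≤ : ∀ x → m ≤ δ h x
        m≤ x = subst (_≤ δ h x) (*-identityˡ m) (H .lower x)
        ≤n : ∀ x → δ h x ≤ n
        ≤n x = subst (δ h x ≤_) (*-identityˡ n) (H .upper x)
        lower' : ∀ x → s * m ≤ s * δ h x
        lower' x = *-monoˡ (<⇒≤ 0<s) (m≤ x)
        upper' : ∀ x → s * δ h x ≤ s * n
        upper' x = *-monoˡ (<⇒≤ 0<s) (≤n x)
        H' : Factor F s h'
        H' = record { weight = W' ; nonneg = h'≥0 ; lower = lo ; upper = up }
          where
          lo : ∀ x → s * m ≤ δ h' x
          lo x with unb x
          ... | inj₁ z = subst (s * m ≤_) (sym (δ-fixed x z)) (lower' x)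
          ... | inj₂ (nn , _) = ≤-trans (lower' x) (≤-by (t * δ p x) (*-≥0 0≤t nn) (δ≡ x))
          up : ∀ x → δ h' x ≤ s * n
          up x with unb x
          ... | inj₁ z = subst (_≤ s * n) (sym (δ-fixed x z)) (upper' x)
          ... | inj₂ (_ , y , leaf , z) =
              subst (_≤ s * n) (sym (trans (δ-leaf leaf W') (proj₁ W' x y)))
            (≤-trans (term≤sum (h'≥0 y) x) (subst (_≤ s * n) (sym (δ-fixed y z)) (upper' y)))

      -- A nonzero entry would be negative in `p` or in its negative, and both leave all degrees
      -- unchanged, so that `push` applies.
      null-weight : ∀ {p} → Weight F p → (∀ x → δ p x ≡ 0ℤ) → ∀ a b → p a b ≡ 0ℤ
      null-weight {p} W z a b with <-cmp (p a b) 0ℤ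
      ... | tri< lt _ _ = ⊥-elim (push W (inj₁ ∘ z) a b lt)
      ... | tri≈ _ eq _ = eq
      ... | tri> _ _ gt = ⊥-elim (push (Weight-lin F -1ℤ p 0ℤ p W W)
        (λ x → inj₁ (trans (δ-lin -1ℤ p 0ℤ p x) (cong (λ w → -1ℤ * w + 0ℤ * w) (z x)))) a b
        (subst (_< 0ℤ) (go (p a b)) (neg-mono-< gt)))
        where
        go : ∀ x → - x ≡ -1ℤ * x + 0ℤ * x
        go = solve-∀

      -- The difference of the two weights is null. In other words, the incidence map from edge
      -- weights to degrees is injective on a critical graph.
      degrees-determine : ∀ {p q} → Weight F p → Weight F q → (∀ x → δ p x ≡ δ q x) → ∀ a b →
          p a b ≡ q a b
      degrees-determine {p} {q} P Q eq a b = i-j≡0⇒i≡j (p a b) (q a b) (trans (go (p a b) (q a b))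
        (null-weight (Weight-lin F 1ℤ p -1ℤ q P Q)
          (λ x → trans (δ-lin 1ℤ p -1ℤ q x)
              (trans (cong (λ w → 1ℤ * δ p x + -1ℤ * w) (sym (eq x))) (z (δ p x)))) a b))
        where
        go : ∀ x y → x - y ≡ 1ℤ * x + -1ℤ * y
        go = solve-∀
        z : ∀ x → 1ℤ * x + -1ℤ * x ≡ 0ℤ
        z = solve-∀

      -- Degree 2 instead of 1 at `x` keeps the weights integral: on an odd cycle degree 1 would
      -- require entries of plus or minus one half.
      Doubles : EdgeFun N → Fin N → Set
      Doubles p x = Weight F p × (∀ y → δ p y ≡ + 2 * e x y)

      -- The weights p + q and 2 `E x y` have the same degrees, so they coincide; but on xy the
      -- first is 0 and the second is 2. The summand with coefficient 0 only brings the second into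
      -- the form `lin`.
      no-chord : ∀ {x y p q} → adj F x y ≡ true → Doubles p x → Doubles q y → p x y ≡ 0ℤ →
          q x y ≡ 0ℤ → ⊥
      no-chord {x} {y} {p} {q} xy (P , δp) (Q , δq) px qx =
          absurd (trans (sym (cong (λ u → + 2 * u + 0ℤ * p x y) (E-on (adj⇒≢ F xy))))
        (trans (degrees-determine {lin (+ 2) (E x y) 0ℤ p} {lin 1ℤ p 1ℤ q}
          (Weight-lin F (+ 2) (E x y) 0ℤ p (Weight-E F xy) P) (Weight-lin F 1ℤ p 1ℤ q P Q) deg x y)
          (cong₂ (λ u v → 1ℤ * u + 1ℤ * v) px qx)))
        where
        absurd : + 2 * 1ℤ + 0ℤ * p x y ≢ 0ℤ
        absurd ()
        deg : ∀ z → δ (lin (+ 2) (E x y) 0ℤ p) z ≡ δ (lin 1ℤ p 1ℤ q) z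
        deg z = trans (δ-lin (+ 2) (E x y) 0ℤ p z)
            (trans (cong (λ w → + 2 * w + 0ℤ * δ p z) (δ-E x y z))
          (trans (go (e x z) (e y z) (δ p z))
              (sym (trans (δ-lin 1ℤ p 1ℤ q z) (cong₂ (λ u v → 1ℤ * u + 1ℤ * v) (δp z) (δq z))))))
          where
          go : ∀ a b c → + 2 * (a + b) + 0ℤ * c ≡ 1ℤ * (+ 2 * a) + 1ℤ * (+ 2 * b)
          go = solve-∀

      -- The degrees are 2 (e x + e z) - 2 e x = 2 e z when `p` doubles `x`: a solution at `x` is
      -- carried over the edge xz to a solution at `z`.
      reflect : Fin N → Fin N → EdgeFun N → EdgeFun N
      reflect x z p = lin (+ 2) (E x z) -1ℤ p

      Doubles-reflect : ∀ {x z p} → adj F x z ≡ true → Doubles p x → Doubles (reflect x z p) z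
      Doubles-reflect {x} {z} {p} xz (P , δp) = Weight-lin F (+ 2) (E x z) -1ℤ p (Weight-E F xz) P ,
        λ y → trans (δ-lin (+ 2) (E x z) -1ℤ p y)
            (trans (cong₂ (λ u v → + 2 * u + -1ℤ * v) (δ-E x z y) (δp y))
          (go (e x y) (e z y)))
        where
        go : ∀ a b → + 2 * (a + b) + -1ℤ * (+ 2 * a) ≡ + 2 * b
        go = solve-∀

      -- The single edge at the leaf carries all of its degree, so p x y = 2, while the row of `y`
      -- sums to 0. That row therefore has a negative entry, and `p` can be pushed since only the
      -- leaf's degree grows.
      no-leaf : ∀ {x y p} → Leaf x y → Doubles p x → ⊥
      no-leaf {x} {y} {p} leaf@(xy , only) (P , δp) with any? (λ b → p y b <? 0ℤ)
      ... | yes (b , neg) = push P unb y b neg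
        where
        unb : ∀ z → Unbounded p z
        unb z with z ≟ x
        ... | no ne = inj₁ (trans (δp z) (cong (+ 2 *_) (e-diff ne)))
        ... | yes refl = inj₂
            (subst (0ℤ ≤_) (sym (trans (δp x) (cong (+ 2 *_) (e-same x)))) (+≤+ ℕ.z≤n) ,
          y , leaf , trans (δp y) (cong (+ 2 *_) (e-diff (adj⇒≢ F xy ∘ sym))))
      ... | no nonneg = <⇒≱ {+ 0} {+ 2} (+<+ (ℕ.s≤s ℕ.z≤n))
        (subst₂ _≤_ (trans (proj₁ P y x)
            (trans (sym (δ-leaf leaf P)) (trans (δp x) (cong (+ 2 *_) (e-same x)))))
          (trans (δp y) (cong (+ 2 *_) (e-diff (adj⇒≢ F xy ∘ sym))))
          (term≤sum (λ b → ≮⇒≥ λ neg → nonneg (b , neg)) x))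

      SolvedIn : Subset N → Fin N → Set
      SolvedIn X x = ∃ λ p → Doubles p x × (∀ a b → lookup X a ≡ false → p a b ≡ 0ℤ)

      -- The last vertex that can be attached to X is a leaf, by uniqueness of the solutions.
      no-exit : ∀ fuel (X : Subset N) → N ℕ.≤ fuel ℕ.+ ∣ X ∣ →
          (∀ x → lookup X x ≡ true → SolvedIn X x) →
        ∀ x z → lookup X x ≡ true → lookup X z ≡ false → adj F x z ≡ true → ⊥
      no-exit zero X bound sol x z xX zX xz =
        ℕ.<⇒≱ (subst (ℕ._≤ N) (insert-size X z zX) (∣p∣≤n (X [ z ]≔ true))) bound
      no-exit (suc fuel) X bound sol x z xX zX xz
        with any? (λ x' → any? λ z' →
            (lookup X' x' ≟ᵇ true) ×-dec (lookup X' z' ≟ᵇ false) ×-dec (adj F x' z' ≟ᵇ true))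
        where X' = X [ z ]≔ true
      ... | yes (x' , z' , x'X , z'X , x'z') = no-exit fuel (X [ z ]≔ true)
        (subst (N ℕ.≤_) (sym (trans (cong (fuel ℕ.+_) (insert-size X z zX)) (ℕ.+-suc fuel _)))
            bound)
        sol' x' z' x'X z'X x'z'
        where
        X' = X [ z ]≔ true
        shrink : ∀ a → lookup X' a ≡ false → lookup X a ≡ false × a ≢ z
        shrink a f = out (lookup X a) refl , λ { refl → true≢false (lookup∘update z X true) f }
          where
          out : ∀ b → lookup X a ≡ b → lookup X a ≡ false
          out false p = p
          out true p = ⊥-elim (true≢false (insert-⊆ X z p) f)
        sol' : ∀ y → lookup X' y ≡ true → SolvedIn X' y
        sol' y yX' with insert-∈ X z yX'
        ... | inj₂ yX with sol y yX
        ... | p , D , supp = p , D , λ a b f → supp a b (proj₁ (shrink a f))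
        sol' y yX' | inj₁ refl with sol x xX
        ... | p , D , supp = reflect x z p , Doubles-reflect xz D , λ a b f →
          cong₂ (λ u v → + 2 * u + -1ℤ * v)
            (E-off x z a b λ { (inj₁ (refl , _)) → true≢false xX (proj₁ (shrink a f))
                             ; (inj₂ (refl , _)) → proj₂ (shrink a f) refl })
            (supp a b (proj₁ (shrink a f)))
      ... | no closed with sol x xX
      ... | p , D , supp = no-leaf (adj-flip F xz , only) (Doubles-reflect xz D)
        where
        X' = X [ z ]≔ true
        only : ∀ u → adj F z u ≡ true → u ≡ x
        only u zu with u ≟ x
        ... | yes q = q
        ... | no ne with insert-∈ X z {u} (inside (lookup X' u) refl)
          where
          inside : ∀ b → lookup X' u ≡ b → lookup X' u ≡ true
          inside true q = q
          inside false q = ⊥-elim (closed (z , u , lookup∘update z X true , q , zu))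
        ... | inj₁ refl = ⊥-elim (adj⇒≢ F zu refl)
        ... | inj₂ uX with sol u uX
        -- Reflecting through `x` and through `u` gives two solutions at `z`, which must agree; yet
        -- on zx they have the values 2 and 0, because neither `p` nor `p'` meets `z`.
        ... | p' , D' , supp' = ⊥-elim (absurd (trans (sym at-xz) (trans
          (degrees-determine {reflect x z p} {reflect u z p'} (proj₁ R) (proj₁ R')
              (λ y → trans (proj₂ R y) (sym (proj₂ R' y))) z x) at-xz')))
          where
          R = Doubles-reflect xz D
          R' = Doubles-reflect (adj-flip F zu) D'
          absurd : + 2 ≢ 0ℤ
          absurd ()
          at-xz : reflect x z p z x ≡ + 2
          at-xz = cong₂ (λ u v → + 2 * u + -1ℤ * v) (trans (E-sym x z z x) (E-on (adj⇒≢ F xz)))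
              (supp z x zX)
          at-xz' : reflect u z p' z x ≡ 0ℤ
          at-xz' = cong₂ (λ u v → + 2 * u + -1ℤ * v)
            (E-off u z z x λ { (inj₁ (_ , refl)) → adj⇒≢ F xz refl ; (inj₂ (_ , q)) → ne (sym q) })
            (supp' z x zX)

  -- Cycles in critical graphs

  parity : ∀ k → ∃ λ i → k ≡ i ℕ.+ i ⊎ k ≡ suc (i ℕ.+ i)
  parity zero = 0 , inj₁ refl
  parity (suc k) with parity k
  ... | i , inj₁ p = i , inj₂ (cong suc p)
  ... | i , inj₂ p = suc i , inj₁ (trans (cong suc p) (cong suc (sym (ℕ.+-suc i i))))

  record Cycle {N} (F : Graph N) (ℓ : ℕ) (g : ℕ → Fin N) : Set where
    field
      long : 3 ℕ.≤ ℓ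
      back : g ℓ ≡ g 0
      inj  : ∀ {i j} → i ℕ.< ℓ → j ℕ.< ℓ → g i ≡ g j → i ≡ j
      edge : ∀ {k} → k ℕ.< ℓ → adj F (g k) (g (suc k)) ≡ true

  -- The edge entering g k along the cycle carries the weight c k.
  module Around {N : ℕ} {F : Graph N} {ℓ' : ℕ} {g : ℕ → Fin N} (C : Cycle F (suc ℓ') g) where

    open Cycle C

    ℓ = suc ℓ'

    Q : (ℕ → ℤ) → ℕ → EdgeFun N
    Q c zero = λ _ _ → 0ℤ
    Q c (suc K) = lin 1ℤ (Q c K) (c (suc K)) (E (g K) (g (suc K)))

    Weight-Q : ∀ c K → K ℕ.≤ ℓ → Weight F (Q c K)
    Weight-Q c zero _ = (λ _ _ → refl) , (λ _ _ _ → refl)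
    Weight-Q c (suc K) K<ℓ = Weight-lin F 1ℤ (Q c K) (c (suc K)) (E (g K) (g (suc K)))
      (Weight-Q c K (ℕ.<⇒≤ K<ℓ)) (Weight-E F (edge K<ℓ))

    Q-off : ∀ c K {a b} → (∀ k → k ℕ.< K → ¬ SamePair (g k) (g (suc k)) a b) → Q c K a b ≡ 0ℤ
    Q-off c zero off = refl
    Q-off c (suc K) {a} {b} off = trans (cong₂ (λ u v → 1ℤ * u + c (suc K) * v)
      (Q-off c K λ k k<K → off k (ℕ.m<n⇒m<1+n k<K)) (E-off _ _ a b (off K ℕ.≤-refl)))
      (trans (+-identityˡ (c (suc K) * 0ℤ)) (*-zeroʳ (c (suc K))))

    Q≥0 : ∀ c K → (∀ k → k ℕ.≤ K → 0ℤ ≤ c k) → ∀ a b → 0ℤ ≤ Q c K a b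
    Q≥0 c zero c≥0 a b = ≤-refl
    Q≥0 c (suc K) c≥0 a b = +-≥0
      (*-≥0 {1ℤ} (+≤+ ℕ.z≤n) (Q≥0 c K (λ k k≤K → c≥0 k (ℕ.m≤n⇒m≤1+n k≤K)) a b))
      (*-≥0 (c≥0 (suc K) ℕ.≤-refl) (E≥0 (g K) (g (suc K)) a b))

    degree : (ℕ → ℤ) → ℕ → Fin N → ℤ
    degree c zero x = 0ℤ
    degree c (suc K) x = degree c K x + (c K + c (suc K)) * e (g K) x

    -- `degree` assigns to g k, for k < K, the weights of both its entering and its leaving edge. On
    -- the open path this counts an absent edge into g 0 and misses the end of the last edge at g K;
    -- the extra terms correct both, and they cancel when the path closes up.
    δ-Q : ∀ c K x → δ (Q c K) x + c 0 * e (g 0) x ≡ degree c K x + c K * e (g K) x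
    δ-Q c zero x = cong (λ z → z + c 0 * e (g 0) x) (sum-const-0 N)
    δ-Q c (suc K) x = trans
      (cong (λ z → z + c 0 * e (g 0) x)
          (trans (δ-lin 1ℤ (Q c K) (c (suc K)) (E (g K) (g (suc K))) x)
        (cong (λ z → 1ℤ * δ (Q c K) x + c (suc K) * z) (δ-E (g K) (g (suc K)) x))))
      (trans (l₁ (δ (Q c K) x) (c (suc K)) (e (g K) x) (e (g (suc K)) x) (c 0 * e (g 0) x))
      (trans (cong (λ z → z + c (suc K) * (e (g K) x + e (g (suc K)) x)) (δ-Q c K x))
        (l₂ (degree c K x) (c K) (c (suc K)) (e (g K) x) (e (g (suc K)) x))))
      where
      l₁ : ∀ q c u v z → 1ℤ * q + c * (u + v) + z ≡ q + z + c * (u + v)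
      l₁ = solve-∀
      l₂ : ∀ d c c' u v → d + c * u + c' * (u + v) ≡ d + (c + c') * u + c' * v
      l₂ = solve-∀

    δ-Q-closed : ∀ c → c ℓ ≡ c 0 → ∀ x → δ (Q c ℓ) x ≡ degree c ℓ x
    δ-Q-closed c cyc x = +-cancelʳ (c 0 * e (g 0) x) (δ (Q c ℓ) x) (degree c ℓ x) (trans (δ-Q c ℓ x)
      (cong₂ (λ u v → degree c ℓ x + u * e v x) cyc back))
      where
      +-cancelʳ : ∀ z a b → a + z ≡ b + z → a ≡ b
      +-cancelʳ z a b p = trans (sym (l a z)) (trans (cong (_- z) p) (l b z))
        where
        l : ∀ a z → a + z - z ≡ a
        l = solve-∀

    degree-off : ∀ c K {x} → (∀ k → k ℕ.< K → x ≢ g k) → degree c K x ≡ 0ℤ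
    degree-off c zero off = refl
    degree-off c (suc K) {x} off = trans (cong₂ (λ u v → u + (c K + c (suc K)) * v)
      (degree-off c K λ k k<K → off k (ℕ.m<n⇒m<1+n k<K)) (e-diff (off K ℕ.≤-refl)))
      (trans (+-identityˡ ((c K + c (suc K)) * 0ℤ)) (*-zeroʳ (c K + c (suc K))))

    degree-on : ∀ c K {j} → j ℕ.< K → K ℕ.≤ ℓ → degree c K (g j) ≡ c j + c (suc j)
    degree-on c (suc K) {j} j<K K≤ℓ with j ℕ.≟ K
    ... | yes refl = trans (cong₂ (λ u v → u + (c j + c (suc j)) * v)
        (degree-off c K λ k k<K p → ℕ.<⇒≢ k<K (sym (inj K≤ℓ (ℕ.<-≤-trans k<K (ℕ.<⇒≤ K≤ℓ)) p)))
            (e-same (g j)))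
        (trans (+-identityˡ ((c j + c (suc j)) * 1ℤ)) (*-identityʳ (c j + c (suc j))))
    ... | no ne = trans (cong₂ (λ u v → u + (c K + c (suc K)) * v)
        (degree-on c K (ℕ.≤∧≢⇒< (ℕ.≤-pred j<K) ne) (ℕ.<⇒≤ K≤ℓ))
        (e-diff λ p → ne (inj (ℕ.<-≤-trans j<K K≤ℓ) K≤ℓ p)))
        (trans (cong (λ z → c j + c (suc j) + z) (*-zeroʳ (c K + c (suc K))))
            (+-identityʳ (c j + c (suc j))))

    -- Needs ℓ ≥ 3: for ℓ = 2 the closing edge is the first edge.
    closing-new : ∀ k → k ℕ.< ℓ' → ¬ SamePair (g k) (g (suc k)) (g ℓ') (g ℓ)
    closing-new k k<ℓ' (inj₁ (p , _)) = ℕ.<⇒≢ k<ℓ' (sym (inj ℕ.≤-refl (ℕ.m<n⇒m<1+n k<ℓ') p))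
    closing-new k k<ℓ' (inj₂ (p , q)) with inj {0} {k} (ℕ.s≤s ℕ.z≤n) (ℕ.m<n⇒m<1+n k<ℓ')
        (trans (sym back) q)
    ... | refl with inj {ℓ'} {1} ℕ.≤-refl (ℕ.s≤s k<ℓ') p
    closing-new _ _ (inj₂ _) | refl | refl with long
    ... | ℕ.s≤s (ℕ.s≤s ())

    Q-closing : ∀ c → Q c ℓ (g ℓ') (g ℓ) ≡ c ℓ
    Q-closing c = trans (cong₂ (λ u v → 1ℤ * u + c ℓ * v) (Q-off c ℓ' closing-new)
      (E-on (adj⇒≢ F (edge ℕ.≤-refl)))) (trans (+-identityˡ (c ℓ * 1ℤ)) (*-identityʳ (c ℓ)))

    OnCycle : Fin N → Set
    OnCycle x = ∃ λ k → k ℕ.< ℓ × x ≡ g k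

    onCycle? : ∀ x → Dec (OnCycle x)
    onCycle? x = ℕ.anyUpTo? (λ k → x ≟ g k) ℓ

    CycleEdge : Fin N → Fin N → Set
    CycleEdge a b = ∃ λ k → k ℕ.< ℓ × SamePair (g k) (g (suc k)) a b

    cycleEdge? : ∀ a b → Dec (CycleEdge a b)
    cycleEdge? a b = ℕ.anyUpTo? (λ k → samePair? (g k) (g (suc k)) a b) ℓ

    suc-on : ∀ {k} → k ℕ.< ℓ → OnCycle (g (suc k))
    suc-on {k} k<ℓ with suc k ℕ.≟ ℓ
    ... | yes refl = 0 , ℕ.s≤s ℕ.z≤n , back
    ... | no ne = suc k , ℕ.≤∧≢⇒< k<ℓ ne , refl

    CycleEdge⇒OnCycle : ∀ {a b} → CycleEdge a b → OnCycle a × OnCycle b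
    CycleEdge⇒OnCycle (k , k<ℓ , inj₁ (refl , refl)) = (k , k<ℓ , refl) , suc-on k<ℓ
    CycleEdge⇒OnCycle (k , k<ℓ , inj₂ (refl , refl)) = suc-on k<ℓ , (k , k<ℓ , refl)

    alt : ℕ → ℤ
    alt zero = -1ℤ
    alt (suc k) = - alt k

    alt-even : ∀ i → alt (i ℕ.+ i) ≡ -1ℤ
    alt-even zero = refl
    alt-even (suc i) = trans (cong (λ z → - alt z) (ℕ.+-suc i i))
        (trans (neg-involutive (alt (i ℕ.+ i))) (alt-even i))

    degree-alt : ∀ K x → degree alt K x ≡ 0ℤ
    degree-alt zero x = refl
    degree-alt (suc K) x = cong₂ (λ u v → u + v * e (g K) x) (degree-alt K x) (+-inverseʳ (alt K))

    -- Consecutive signs cancel everywhere except at g 0, where the first edge, of weight 1, meets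
    -- the closing edge, of weight `alt ℓ`. The result is 0 for even and 2 for odd length.
    δ-Q-alt : ∀ x → δ (Q alt ℓ) x ≡ e (g 0) x + alt ℓ * e (g 0) x
    δ-Q-alt x = trans (l₁ (δ (Q alt ℓ) x) (e (g 0) x))
        (cong (λ z → e (g 0) x + z) (trans (δ-Q alt ℓ x)
      (trans (cong₂ (λ u v → u + alt ℓ * e v x) (degree-alt ℓ x) back)
          (+-identityˡ (alt ℓ * e (g 0) x)))))
      where
      l₁ : ∀ a b → a ≡ b + (a + -1ℤ * b)
      l₁ = solve-∀

  module CriticalCycle (m n : ℤ) (0<m : 0ℤ < m) (m<n : m < n) {N : ℕ} {F : Graph N}
    (critical : Minimal.Critical m n 0<m m<n F) {ℓ' : ℕ} {g : ℕ → Fin N} (C : Cycle F (suc ℓ') g)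
        where

    open Bounds m n 0<m m<n
    open Minimal m n 0<m m<n
    open Pushing F critical
    open Around C
    open Cycle C

    cycle-odd : ∃ λ i → ℓ ≡ suc (i ℕ.+ i)
    cycle-odd with parity ℓ
    ... | i , inj₂ odd = i , odd
    ... | i , inj₁ even = ⊥-elim (absurd (trans (sym alt-ℓ) (trans (sym (Q-closing alt))
        (null-weight {Q alt ℓ} (Weight-Q alt ℓ ℕ.≤-refl)
          (λ x → trans (δ-Q-alt x)
              (trans (cong (λ z → e (g 0) x + z * e (g 0) x) alt-ℓ) (l (e (g 0) x))))
          (g ℓ') (g ℓ)))))
      where
      alt-ℓ : alt ℓ ≡ -1ℤ
      alt-ℓ = trans (cong alt even) (alt-even i)
      absurd : -1ℤ ≢ 0ℤ
      absurd ()
      l : ∀ a → a + -1ℤ * a ≡ 0ℤ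
      l = solve-∀

    alt-ℓ≡1 : alt ℓ ≡ 1ℤ
    alt-ℓ≡1 with cycle-odd
    ... | i , odd = trans (cong alt odd) (cong (-_) (alt-even i))

    -- The alternating weight solves g 0, and reflections in cycle edges carry the solution around
    -- without leaving the cycle.
    solved : ∀ k → k ℕ.≤ ℓ → ∃ λ p → Doubles p (g k) × (∀ a b → ¬ CycleEdge a b → p a b ≡ 0ℤ)
    solved zero _ = Q alt ℓ , (Weight-Q alt ℓ ℕ.≤-refl ,
      λ y → trans (δ-Q-alt y)
          (trans (cong (λ z → e (g 0) y + z * e (g 0) y) alt-ℓ≡1) (l (e (g 0) y)))) ,
      λ a b off → Q-off alt ℓ λ k k<ℓ s → off (k , k<ℓ , s)
      where
      l : ∀ a → a + 1ℤ * a ≡ + 2 * a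
      l = solve-∀
    solved (suc k) k<ℓ with solved k (ℕ.<⇒≤ k<ℓ)
    ... | p , D , supp = reflect (g k) (g (suc k)) p , Doubles-reflect (edge k<ℓ) D ,
      λ a b off → cong₂ (λ u v → + 2 * u + -1ℤ * v)
        (E-off (g k) (g (suc k)) a b λ s → off (k , k<ℓ , s)) (supp a b off)

    -- Any other edge at `a` either is a chord, excluded by the solutions at its two ends, or leaves
    -- the cycle, excluded by `no-exit` applied to the vertex set of the cycle.
    no-other-edge : ∀ {a b} → OnCycle a → adj F a b ≡ true → CycleEdge a b
    no-other-edge {a} {b} (j , j<ℓ , refl) ab with cycleEdge? a b | onCycle? b
    ... | yes on | _ = on
    ... | no off | yes (k , k<ℓ , refl) with solved j (ℕ.<⇒≤ j<ℓ) | solved k (ℕ.<⇒≤ k<ℓ)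
    ... | p , D , supp | p' , D' , supp' =
      ⊥-elim (no-chord {p = p} {p'} ab D D' (supp a b off) (supp' a b off))
    no-other-edge {a} {b} (j , j<ℓ , refl) ab | no off | no b-off =
      ⊥-elim (no-exit N X (ℕ.m≤m+n N _) sol a b
        (X⇐ (j , j<ℓ , refl)) (out b b-off) ab)
      where
      X : Subset N
      X = tabulate λ x → isYes (onCycle? x)
      X⇒ : ∀ {x} → lookup X x ≡ true → OnCycle x
      X⇒ {x} p = isYes⇒ (onCycle? x) (trans (sym (lookup∘tabulate _ x)) p)
      X⇐ : ∀ {x} → OnCycle x → lookup X x ≡ true
      X⇐ {x} p = trans (lookup∘tabulate _ x) (isYes⇐ (onCycle? x) p)
      out : ∀ x → ¬ OnCycle x → lookup X x ≡ false
      out x off = go (lookup X x) refl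
        where
        go : ∀ v → lookup X x ≡ v → lookup X x ≡ false
        go true p = ⊥-elim (off (X⇒ p))
        go false p = p
      sol : ∀ x → lookup X x ≡ true → SolvedIn X x
      sol x xX with X⇒ xX
      ... | k , k<ℓ , refl with solved k (ℕ.<⇒≤ k<ℓ)
      ... | p , D , supp = p , D , λ a b f → supp a b λ on →
        true≢false (X⇐ (proj₁ (CycleEdge⇒OnCycle on))) f

    -- Otherwise the cycle carries a factor that avoids the closing edge: its degrees alternate
    -- between m and (i + 1) m / i, here scaled by i.
    short : ∀ {i} → ℓ ≡ suc (i ℕ.+ i) → 0ℤ < + i → + i * n < + (suc i) * m
    short {i} ℓ≡ 0<i with + i * n <? + (suc i) * m
    ... | yes lt = lt
    ... | no ≮ = ⊥-elim (full-support 0<i H' (g ℓ') (g ℓ) (edge ℕ.≤-refl)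
        (trans (h'-on (ℓ' , ℕ.≤-refl , refl) (g ℓ)) (trans (Q-closing c) c-ℓ)))
      where
      D : ℕ → ℤ
      D zero = + i * m
      D (suc zero) = + (suc i) * m
      D (suc (suc k)) = D k
      -- The recursion prescribes the degree c k + c (k + 1) = D k at g k. Starting from 0 it gives
      -- c (2j) = j m and c (2j + 1) = (i - j) m, which is nonnegative along the cycle and returns
      -- to 0 at ℓ = 2i + 1.
      c : ℕ → ℤ
      c zero = 0ℤ
      c (suc k) = D k - c k
      D-even : ∀ j → D (j ℕ.+ j) ≡ + i * m
      D-even zero = refl
      D-even (suc j) = trans (cong (λ z → D (suc z)) (ℕ.+-suc j j)) (D-even j)
      D-odd : ∀ j → D (suc (j ℕ.+ j)) ≡ + (suc i) * m
      D-odd zero = refl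
      D-odd (suc j) = trans (cong (λ z → D (suc (suc z))) (ℕ.+-suc j j)) (D-odd j)
      c-even : ∀ j → c (j ℕ.+ j) ≡ + j * m
      c-even zero = refl
      c-even (suc j) = trans (cong (λ z → c (suc z)) (ℕ.+-suc j j))
        (trans (cong₂ (λ u v → u - (v - c (j ℕ.+ j))) (D-odd j) (D-even j))
        (trans (cong (λ z → + (suc i) * m - (+ i * m - z)) (c-even j)) (l (+ i) (+ j) m)))
        where
        l : ∀ i j m → (1ℤ + i) * m - (i * m - j * m) ≡ (1ℤ + j) * m
        l = solve-∀
      c-odd : ∀ j → c (suc (j ℕ.+ j)) ≡ (+ i - + j) * m
      c-odd j = trans (cong₂ _-_ (D-even j) (c-even j)) (l (+ i) (+ j) m)
        where
        l : ∀ i j m → i * m - j * m ≡ (i - j) * m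
        l = solve-∀
      c-ℓ : c ℓ ≡ 0ℤ
      c-ℓ = trans (cong c ℓ≡) (trans (c-odd i) (cong (_* m) (+-inverseʳ (+ i))))
      double-≤ : ∀ {j k} → j ℕ.+ j ℕ.≤ k ℕ.+ k → j ℕ.≤ k
      double-≤ {j} {k} le with j ℕ.≤? k
      ... | yes p = p
      ... | no ≰ = ⊥-elim (ℕ.<⇒≱ (ℕ.+-mono-< (ℕ.≰⇒> ≰) (ℕ.≰⇒> ≰)) le)
      c≥0 : ∀ k → k ℕ.≤ ℓ → 0ℤ ≤ c k
      c≥0 k k≤ℓ with parity k
      ... | j , inj₁ refl = subst (0ℤ ≤_) (sym (c-even j)) (*-≥0 {+ j} (+≤+ ℕ.z≤n) (<⇒≤ 0<m))
      ... | j , inj₂ refl = subst (0ℤ ≤_) (sym (c-odd j))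
        (*-≥0 (i≤j⇒0≤j-i {+ j} (+≤+ (double-≤ (ℕ.≤-pred (subst (k ℕ.≤_) ℓ≡ k≤ℓ))))) (<⇒≤ 0<m))
      bounds : ∀ k → + i * m ≤ D k × D k ≤ + i * n
      bounds zero = ≤-refl , *-monoˡ (<⇒≤ 0<i) (<⇒≤ m<n)
      bounds (suc zero) = ≤-by m (<⇒≤ 0<m) (l (+ i) m) , ≮⇒≥ ≮
        where
        l : ∀ i m → (1ℤ + i) * m ≡ i * m + m
        l = solve-∀
      bounds (suc (suc k)) = bounds k
      base = Augment.C1⇒Factor m n 0<m m<n F (proj₁ critical)
      h = proj₁ base
      H = proj₂ base
      -- The cycle gets its own weights and the rest keeps a factor of F, scaled to the same
      -- denominator i. The two match because no edge leaves the cycle.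
      patch : ∀ {a} → Dec (OnCycle a) → Fin N → ℤ
      patch {a} (yes _) b = Q c ℓ a b
      patch {a} (no _) b = + i * h a b
      h' : EdgeFun N
      h' a b = patch (onCycle? a) b
      h'-on : ∀ {a} → OnCycle a → ∀ b → h' a b ≡ Q c ℓ a b
      h'-on {a} on b with onCycle? a
      ... | yes _ = refl
      ... | no off = ⊥-elim (off on)
      h'-off : ∀ {a} → ¬ OnCycle a → ∀ b → h' a b ≡ + i * h a b
      h'-off {a} off b with onCycle? a
      ... | yes on = ⊥-elim (off on)
      ... | no _ = refl
      QW : Weight F (Q c ℓ)
      QW = Weight-Q c ℓ ℕ.≤-refl
      zero-off : ∀ a b → adj F a b ≡ false → h' a b ≡ 0ℤ
      zero-off a b f with onCycle? a
      ... | yes _ = proj₂ QW a b f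
      ... | no _ = trans (cong (+ i *_) (proj₂ (H .weight) a b f)) (*-zeroʳ (+ i))
      h'-sym : ∀ a b → h' a b ≡ h' b a
      h'-sym a b = split (adj F a b) refl (onCycle? a) (onCycle? b)
        where
        split : ∀ v → adj F a b ≡ v → Dec (OnCycle a) → Dec (OnCycle b) → h' a b ≡ h' b a
        split false f _ _ = trans (zero-off a b f) (sym (zero-off b a (trans (adjSym F b a) f)))
        split true ab (yes p) (no q) = ⊥-elim (q (proj₂ (CycleEdge⇒OnCycle (no-other-edge p ab))))
        split true ab (no p) (yes q) =
            ⊥-elim (p (proj₂ (CycleEdge⇒OnCycle (no-other-edge q (adj-flip F ab)))))
        split true ab (yes p) (yes q) = trans (h'-on p b) (trans (proj₁ QW a b) (sym (h'-on q a)))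
        split true ab (no p) (no q) = trans (h'-off p b)
          (trans (cong (+ i *_) (proj₁ (H .weight) a b)) (sym (h'-off q a)))
      h'≥0 : ∀ a b → 0ℤ ≤ h' a b
      h'≥0 a b with onCycle? a
      ... | yes _ = Q≥0 c ℓ c≥0 a b
      ... | no _ = *-≥0 (<⇒≤ 0<i) (H .nonneg a b)
      δ-on : ∀ {j} → j ℕ.< ℓ → δ h' (g j) ≡ D j
      δ-on {j} j<ℓ = trans (sum-cong (h'-on (j , j<ℓ , refl))) (trans (δ-Q-closed c c-ℓ (g j))
        (trans (degree-on c ℓ j<ℓ ℕ.≤-refl) (l (c j) (D j))))
        where
        l : ∀ c d → c + (d - c) ≡ d
        l = solve-∀
      δ-off : ∀ {x} → ¬ OnCycle x → δ h' x ≡ + i * δ h x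
      δ-off {x} off = trans (sum-cong (h'-off off)) (sum-*ˡ (+ i) (h x))
      H' : Factor F (+ i) h'
      H' = record { weight = h'-sym , zero-off ; nonneg = h'≥0
        ; lower = λ x → low x (onCycle? x) ; upper = λ x → up x (onCycle? x) }
        where
        low : ∀ x → Dec (OnCycle x) → + i * m ≤ δ h' x
        low x (yes (j , j<ℓ , refl)) = subst (+ i * m ≤_) (sym (δ-on j<ℓ)) (proj₁ (bounds j))
        low x (no off) = subst (+ i * m ≤_) (sym (δ-off off))
          (*-monoˡ (<⇒≤ 0<i) (subst (_≤ δ h x) (*-identityˡ m) (H .lower x)))
        up : ∀ x → Dec (OnCycle x) → δ h' x ≤ + i * n
        up x (yes (j , j<ℓ , refl)) = subst (_≤ + i * n) (sym (δ-on j<ℓ)) (proj₂ (bounds j))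
        up x (no off) = subst (_≤ + i * n) (sym (δ-off off))
          (*-monoˡ (<⇒≤ 0<i) (subst (δ h x ≤_) (*-identityˡ n) (H .upper x)))

  -- Embedded components

  Bool-ext : ∀ {a b : Bool} → (a ≡ true → b ≡ true) → (b ≡ true → a ≡ true) → a ≡ b
  Bool-ext {true} {b} f g = sym (f refl)
  Bool-ext {false} {false} f g = refl
  Bool-ext {false} {true} f g = g refl

  Reach-trans : ∀ {N} {G : Graph N} {u v w} → Reach G u v → Reach G v w → Reach G u w
  Reach-trans here q = q
  Reach-trans (step a p) q = step a (Reach-trans p q)

  Reach-sym : ∀ {N} {G : Graph N} {u v} → Reach G u v → Reach G v u
  Reach-sym here = here
  Reach-sym {G = G} (step a p) = Reach-trans (Reach-sym p) (step (adj-flip G a) here)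

  image : ∀ {k N} → (Fin k → Fin N) → Fin N → Bool
  image f v = isYes (any? λ i → f i ≟ v)

  sum-image : ∀ {k N} (f : Fin k → Fin N) → Injective _≡_ _≡_ f → (φ : Fin N → ℤ) →
    sum (φ ∘ f) ≡ sum (λ v → pick (image f v) (φ v))
  sum-image f inj φ = trans (sum-cong λ i → sym (at (f i)))
    (trans (sum-swap λ i v → φ v * e (f i) v)
        (sum-cong λ v → trans (sum-*ˡ (φ v) (λ i → e (f i) v)) (hits v)))
    where
    at : ∀ u → sum (λ v → φ v * e u v) ≡ φ u
    at u = trans (sum-single (λ v → φ v * e u v) u λ v ne →
      trans (cong (φ v *_) (e-diff ne)) (*-zeroʳ (φ v)))
      (trans (cong (φ u *_) (e-same u)) (*-identityʳ (φ u)))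
    hits : ∀ v → φ v * sum (λ i → e (f i) v) ≡ pick (image f v) (φ v)
    hits v with any? (λ i → f i ≟ v)
    ... | yes (i , refl) = trans (cong (φ v *_) (trans
      (sum-single (λ j → e (f j) v) i λ j ne → e-diff λ p → ne (inj (sym p))) (e-same v)))
          (*-identityʳ (φ v))
    ... | no miss = trans (cong (φ v *_) (sum-zero λ i → e-diff λ p → miss (i , sym p)))
        (*-zeroʳ (φ v))

  -- `f` identifies H with a union of components of F, since `closed` forbids edges leaving the
  -- image. Isomorphisms of graphs are a special case.
  record Embeds {k N} (H : Graph k) (F : Graph N) (f : Fin k → Fin N) : Set where
    field
      inj    : Injective _≡_ _≡_ f
      same   : ∀ i j → adj H i j ≡ adj F (f i) (f j)
      closed : ∀ i u → adj F (f i) u ≡ true → ∃ λ j → f j ≡ u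

  pullback : ∀ {k N} → (Fin k → Fin N) → Subset N → Subset k
  pullback f S = tabulate (lookup S ∘ f)

  isolated-pullback : ∀ {k N} {H : Graph k} {F : Graph N} {f} → Embeds H F f → ∀ S i →
    isIsolatedIn- H (pullback f S) i ≡ isIsolatedIn- F S (f i)
  isolated-pullback {H = H} {F} {f} emb S i = Bool-ext
    (λ p → isolated⇐ F S (f i) (up (isolated⇒ H (pullback f S) i p)))
        (λ p → isolated⇐ H (pullback f S) i (down (isolated⇒ F S (f i) p)))
    where
    open Embeds emb
    S≡ : ∀ j → lookup (pullback f S) j ≡ lookup S (f j)
    S≡ = lookup∘tabulate (lookup S ∘ f)
    up : Iso H (lookup (pullback f S)) i → Iso F (lookup S) (f i)
    up (out , nbrs) = trans (sym (S≡ i)) out , λ u a → onto u a (closed i u a)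
      where
      onto : ∀ u → adj F (f i) u ≡ true → (∃ λ j → f j ≡ u) → lookup S u ≡ true
      onto u a (j , refl) = trans (sym (S≡ j)) (nbrs j (trans (same i j) a))
    down : Iso F (lookup S) (f i) → Iso H (lookup (pullback f S)) i
    down (out , nbrs) = trans (S≡ i) out , λ j a →
        trans (S≡ j) (nbrs (f j) (trans (sym (same i j)) a))

  closed-in : ∀ {k N} {F : Graph N} {f : Fin k → Fin N} →
      (∀ i u → adj F (f i) u ≡ true → ∃ λ j → f j ≡ u) →
    ∀ {u v} → adj F u v ≡ true → image f v ≡ true → image f u ≡ true
  closed-in {F = F} {f} closed {u} {v} a p with isYes⇒ (any? λ i → f i ≟ v) p
  ... | i , refl = isYes⇐ (any? λ i → f i ≟ u) (closed i u (adj-flip F a))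

  module Components (m n : ℤ) (0<m : 0ℤ < m) (m<n : m < n) where

    open Bounds m n 0<m m<n
    open Minimal m n 0<m m<n

    -- The contribution of a single vertex to n |S| - m iso(G - S). In this form `C1` splits into
    -- sums over components.
    surplus : ∀ {N} → Graph N → Subset N → Fin N → ℤ
    surplus G S v = pick (lookup S v) n - pick (isIsolatedIn- G S v) m

    sum-surplus : ∀ {N} (G : Graph N) S → sum (surplus G S) ≡
      sum (λ v → pick (lookup S v) n) - sum (λ v → pick (isIsolatedIn- G S v) m)
    sum-surplus G S = trans (sum-cong λ v → l₁ (pick (lookup S v) n) (pick (isIsolatedIn- G S v) m))
      (trans (sum-lin 1ℤ -1ℤ (λ v → pick (lookup S v) n) (λ v → pick (isIsolatedIn- G S v) m))
        (sym (l₁ (sum (λ v → pick (lookup S v) n)) (sum (λ v → pick (isIsolatedIn- G S v) m)))))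
      where
      l₁ : ∀ a b → a - b ≡ 1ℤ * a + -1ℤ * b
      l₁ = solve-∀

    C1⇒surplus : ∀ {N} (G : Graph N) → C1 G → ∀ S → 0ℤ ≤ sum (surplus G S)
    C1⇒surplus G c1 S = subst (0ℤ ≤_) (sym (sum-surplus G S)) (i≤j⇒0≤j-i (c1 S))

    surplus⇒C1 : ∀ {N} (G : Graph N) → (∀ S → 0ℤ ≤ sum (surplus G S)) → C1 G
    surplus⇒C1 G s S = 0≤i-j⇒j≤i (subst (0ℤ ≤_) (sum-surplus G S) (s S))

    surplus-pullback : ∀ {k N} {H : Graph k} {F : Graph N} {f} → Embeds H F f → ∀ S →
      sum (surplus H (pullback f S)) ≡ sum (λ v → pick (image f v) (surplus F S v))
    surplus-pullback {H = H} {F} {f} emb S = trans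
      (sum-cong λ i → cong₂ (λ a b → pick a n - pick b m) (lookup∘tabulate (lookup S ∘ f) i)
        (isolated-pullback {H = H} {F} emb S i))
      (sum-image f (Embeds.inj emb) (surplus F S))

    -- The passage is through a factor: restricting one of F to H keeps every degree, as no edge
    -- leaves the image, and double counting leads back to `C1`.
    C1-embeds : ∀ {k N} {H : Graph k} {F : Graph N} {f} → Embeds H F f → C1 F → C1 H
    C1-embeds {k} {N} {H} {F} {f} emb c1 with Augment.C1⇒Factor m n 0<m m<n F c1
    ... | h , fac = Factor⇒C1 {G = H} {1ℤ} {λ i j → h (f i) (f j)} (+<+ (ℕ.s≤s ℕ.z≤n)) (record
      { weight = (λ i j → proj₁ (fac .weight) (f i) (f j)) ,
          λ i j p → proj₂ (fac .weight) (f i) (f j) (trans (sym (same i j)) p)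
      ; nonneg = λ i j → fac .nonneg (f i) (f j)
      ; lower = λ i → subst (1ℤ * m ≤_) (sym (deg i)) (fac .lower (f i))
      ; upper = λ i → subst (_≤ 1ℤ * n) (sym (deg i)) (fac .upper (f i)) })
      where
      open Embeds emb
      deg : ∀ i → sum (λ j → h (f i) (f j)) ≡ δ h (f i)
      deg i = trans (sum-image f inj (h (f i))) (sum-cong λ v → entry v (adj F (f i) v) refl)
        where
        entry : ∀ v b → adj F (f i) v ≡ b → pick (image f v) (h (f i) v) ≡ h (f i) v
        entry v true p rewrite isYes⇐ (any? λ j → f j ≟ v) (closed i v p) = refl
        entry v false p rewrite proj₂ (fac .weight) (f i) v p with image f v
        ... | true = refl
        ... | false = refl

    -- Apply (C1) to the part of S outside the component.
    outside-surplus : ∀ {k N} {F : Graph N} {f : Fin k → Fin N} → C1 F →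
      (∀ i u → adj F (f i) u ≡ true → ∃ λ j → f j ≡ u) → ∀ S →
      0ℤ ≤ sum (λ v → pick (not (image f v)) (surplus F S v))
    outside-surplus {F = F} {f} c1 closed S =
        ≤-trans (C1⇒surplus F c1 S₀) (sum-mono λ v → le v (image f v) refl)
      where
      S₀ : Subset _
      S₀ = tabulate λ v → not (image f v) ∧ lookup S v
      S₀≡ : ∀ v → lookup S₀ v ≡ not (image f v) ∧ lookup S v
      S₀≡ = lookup∘tabulate _
      outside : ∀ v → image f v ≡ false → lookup S₀ v ≡ lookup S v
      outside v p rewrite S₀≡ v | p = refl
      nbr-outside : ∀ v u → image f v ≡ false → adj F v u ≡ true → image f u ≡ false
      nbr-outside v u p a = go (image f u) refl
        where
        go : ∀ b → image f u ≡ b → image f u ≡ false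
        go true q = ⊥-elim (true≢false (closed-in {F = F} {f} closed a q) p)
        go false q = q
      iso≡ : ∀ v → image f v ≡ false → isIsolatedIn- F S₀ v ≡ isIsolatedIn- F S v
      iso≡ v p = Bool-ext
        (λ q → let (out , nbrs) = isolated⇒ F S₀ v q in isolated⇐ F S v
          (trans (sym (outside v p)) out , λ u a →
              trans (sym (outside u (nbr-outside v u p a))) (nbrs u a)))
        (λ q → let (out , nbrs) = isolated⇒ F S v q in isolated⇐ F S₀ v
          (trans (outside v p) out , λ u a → trans (outside u (nbr-outside v u p a)) (nbrs u a)))
      le : ∀ v b → image f v ≡ b → surplus F S₀ v ≤ pick (not b) (surplus F S v)
      le v false p = ≤-reflexive (cong₂ (λ a b → pick a n - pick b m) (outside v p) (iso≡ v p))
      -- Inside the image S₀ is empty, so the surplus there is at most 0 and may be dropped.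
      le v true p = ≤-trans
        (≤-reflexive (trans (cong (λ z → pick z n - pick (isIsolatedIn- F S₀ v) m)
          (trans (S₀≡ v) (cong (λ z → not z ∧ lookup S v) p)))
              (+-identityˡ (- pick (isIsolatedIn- F S₀ v) m))))
        (neg-mono-≤ (pick≥0 (isIsolatedIn- F S₀ v)))
        where
        pick≥0 : ∀ b → 0ℤ ≤ pick b m
        pick≥0 true = <⇒≤ 0<m
        pick≥0 false = ≤-refl

    split-sum : ∀ {N} (b : Fin N → Bool) (φ : Fin N → ℤ) →
      sum φ ≡ sum (λ v → pick (b v) (φ v)) + sum (λ v → pick (not (b v)) (φ v))
    split-sum b φ = trans (sum-cong λ v → go (b v) (φ v))
        (sum-+ (λ v → pick (b v) (φ v)) (λ v → pick (not (b v)) (φ v)))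
      where
      go : ∀ b x → x ≡ pick b x + pick (not b) x
      go true x = sym (+-identityʳ x)
      go false x = sym (+-identityˡ x)

    deleteEdge-embeds : ∀ {k N} {H : Graph k} {F : Graph N} {f} → Embeds H F f → ∀ a b →
      Embeds (deleteEdge H a b) (deleteEdge F (f a) (f b)) f
    deleteEdge-embeds {H = H} {F} {f} emb a b = record
      { inj = inj ; same = same' ; closed = λ i u p →
          closed i u (deleteEdge-⊆ F (f a) (f b) (f i) u p) }
      where
      open Embeds emb
      same' : ∀ i j → adj (deleteEdge H a b) i j ≡ adj (deleteEdge F (f a) (f b)) (f i) (f j)
      same' i j with samePair? a b i j
      ... | yes s = trans (deleteEdge-off H a b s) (sym (deleteEdge-off F (f a) (f b) (up s)))
        where
        up : SamePair a b i j → SamePair (f a) (f b) (f i) (f j)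
        up (inj₁ (refl , refl)) = inj₁ (refl , refl)
        up (inj₂ (refl , refl)) = inj₂ (refl , refl)
      ... | no ns = trans (deleteEdge-on H a b ns)
          (trans (same i j) (sym (deleteEdge-on F (f a) (f b)
        λ { (inj₁ (p , q)) → ns (inj₁ (inj p , inj q)) ; (inj₂ (p , q)) →
            ns (inj₂ (inj p , inj q)) })))

    -- A set violating `C1` in F without the edge has negative total surplus. Outside the component
    -- nothing was deleted, so the part there is nonnegative by `C1` for F. The deficit thus lies
    -- inside, and the pulled-back set is violating in H without the edge.
    Critical-embeds : ∀ {k N} {H : Graph k} {F : Graph N} {f} → Embeds H F f → Critical F →
        Critical H
    Critical-embeds {H = H} {F} {f} emb (c1 , crit) = C1-embeds {H = H} {F} emb c1 , λ a b ab →
        violated a b ab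
      (crit (f a) (f b) (trans (sym (Embeds.same emb a b)) ab))
      where
      open Embeds emb
      violated : ∀ a b → adj H a b ≡ true → Violable (deleteEdge F (f a) (f b)) →
          Violable (deleteEdge H a b)
      violated a b ab (S , v) = pullback f S ,
        i-j<0⇒i<j (subst (_< 0ℤ)
            (trans (sym (surplus-pullback {H = deleteEdge H a b} {F'} emb' S))
                (sum-surplus (deleteEdge H a b) (pullback f S)))
          (≤-<-trans (≤-by outer outer≥0 (split-sum (image f) (surplus F' S)))
            (subst (_< 0ℤ) (sym (sum-surplus F' S)) (i<j⇒i-j<0 v))))
        where
        F' = deleteEdge F (f a) (f b)
        emb' = deleteEdge-embeds {H = H} {F} emb a b
        i<j⇒i-j<0 : ∀ {i j} → i < j → i - j < 0ℤ
        i<j⇒i-j<0 {i} {j} p = subst (i - j <_) (+-inverseʳ j) (+-monoˡ-< (- j) p)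
        i-j<0⇒i<j : ∀ {i j} → i - j < 0ℤ → i < j
        i-j<0⇒i<j {i} {j} p = subst₂ _<_ (l i j) (+-identityˡ j) (+-monoˡ-< j p)
          where
          l : ∀ i j → i - j + j ≡ i
          l = solve-∀
        outer = sum (λ v → pick (not (image f v)) (surplus F' S v))
        nbr≡ : ∀ v → image f v ≡ false → ∀ u → adj F' v u ≡ adj F v u
        nbr≡ v p u = deleteEdge-on F (f a) (f b) λ
          { (inj₁ (q , _)) → true≢false (isYes⇐ (any? λ i → f i ≟ v) (a , sym q)) p
          ; (inj₂ (q , _)) → true≢false (isYes⇐ (any? λ i → f i ≟ v) (b , sym q)) p }
        iso≡ : ∀ v → image f v ≡ false → isIsolatedIn- F' S v ≡ isIsolatedIn- F S v
        iso≡ v p = Bool-ext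
          (λ q → let (out , nbrs) = isolated⇒ F' S v q in isolated⇐ F S v (out , λ u e → nbrs u (trans (nbr≡ v p u) e)))
          (λ q → let (out , nbrs) = isolated⇒ F S v q in isolated⇐ F' S v (out , λ u e → nbrs u (trans (sym (nbr≡ v p u)) e)))
        outer≥0 : 0ℤ ≤ outer
        outer≥0 = subst (0ℤ ≤_) (sum-cong λ v → same-term v (image f v) refl)
            (outside-surplus {F = F} {f} c1 closed S)
          where
          same-term : ∀ v b → image f v ≡ b →
              pick (not b) (surplus F S v) ≡ pick (not b) (surplus F' S v)
          same-term v true p = refl
          same-term v false p = cong (λ z → pick (lookup S v) n - pick z m) (sym (iso≡ v p))

    least : ∀ {N} {P : Fin N → Set} → (∀ u → Dec (P u)) → ∃ P → ∃ λ u →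
        P u × (∀ w → P w → toℕ u ℕ.≤ toℕ w)
    least {suc N} P? (w , Pw) with P? zero
    ... | yes P0 = zero , P0 , λ _ _ → ℕ.z≤n
    least {suc N} P? (zero , Pw) | no ¬P0 = ⊥-elim (¬P0 Pw)
    least {suc N} {P} P? (suc w , Pw) | no ¬P0 with least {P = P ∘ suc} (P? ∘ suc) (w , Pw)
    ... | u , Pu , min = suc u , Pu , λ
      { zero P0 → ⊥-elim (¬P0 P0) ; (suc w') Pw' → ℕ.s≤s (min w' Pw') }

    component-embeds : ∀ {N k} {F : Graph N} {v} {H : Graph k} → ((f , _) : ComponentIso F v H) →
        Embeds H F f
    component-embeds (f , inj , onto , reach , same) = record
      { inj = inj ; same = same
      ; closed = λ i u a → onto u (Reach-trans (reach i) (step a here)) }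

    -- Group the vertices by the least vertex of their component.
    C1-components : ∀ {N} {F : Graph N} →
      (∀ v → ∃ λ k → Σ (Graph k) λ H → C1 H × ComponentIso F v H) → C1 F
    C1-components {N} {F} comp = surplus⇒C1 F λ S → subst (0ℤ ≤_)
      (trans (sum-swap λ r v → surplus F S v * e (rep v) r)
        (sum-cong λ v → trans (sum-*ˡ (surplus F S v) (e (rep v)))
          (trans (cong (surplus F S v *_) (sum-e (rep v))) (*-identityʳ (surplus F S v)))))
      (sum≥0 (class≥0 S))
      where
      reach? : ∀ v u → Dec (Reach F v u)
      reach? v u with comp v
      ... | k , H , _ , f , _ , onto , reach , _ =
        map′ (λ { (i , refl) → reach i }) (onto u) (any? λ i → f i ≟ u)
      rep-spec : ∀ v → ∃ λ r → Reach F v r × (∀ w → Reach F v w → toℕ r ℕ.≤ toℕ w)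
      rep-spec v = least (reach? v) (v , here)
      rep : Fin N → Fin N
      rep v = proj₁ (rep-spec v)
      rep-reach : ∀ v → Reach F v (rep v)
      rep-reach v = proj₁ (proj₂ (rep-spec v))
      rep-cong : ∀ {u v} → Reach F u v → rep u ≡ rep v
      rep-cong {u} {v} p = toℕ-injective (ℕ.≤-antisym
        (proj₂ (proj₂ (rep-spec u)) (rep v) (Reach-trans p (rep-reach v)))
        (proj₂ (proj₂ (rep-spec v)) (rep u) (Reach-trans (Reach-sym p) (rep-reach u))))
      class≥0 : ∀ S r → 0ℤ ≤ sum (λ v → surplus F S v * e (rep v) r)
      class≥0 S r with rep r ≟ r
      -- A vertex that does not represent itself represents no vertex, so its class is empty.
      ... | no ne = sum≥0 λ v → ≤-reflexive (sym (trans (cong (surplus F S v *_)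
        (e-diff λ q → ne (trans (sym (rep-cong (subst (Reach F v) (sym q) (rep-reach v))))
            (sym q)))) (*-zeroʳ (surplus F S v))))
      ... | yes fix = grouped (comp r)
        where
        grouped : (∃ λ k → Σ (Graph k) λ H → C1 H × ComponentIso F r H) →
            0ℤ ≤ sum (λ v → surplus F S v * e (rep v) r)
        grouped (k , H , c1 , iso@(f , _ , onto , reach , _)) = subst (0ℤ ≤_)
          (trans (surplus-pullback {H = H} {F} (component-embeds {F = F} {H = H} iso) S)
            (sum-cong λ v → member v (any? λ i → f i ≟ v)))
          (C1⇒surplus H c1 (pullback f S))
          where
          member : ∀ v (d : Dec (∃ λ i → f i ≡ v)) →
              pick (isYes d) (surplus F S v) ≡ surplus F S v * e (rep v) r
          member v (yes (i , refl)) =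
              sym (trans (cong (λ z → surplus F S v * e z r) (trans (sym (rep-cong (reach i))) fix))
            (trans (cong (surplus F S v *_) (e-same r)) (*-identityʳ (surplus F S v))))
          member v (no miss) = sym (trans (cong (surplus F S v *_) (e-diff λ q →
            miss (onto v (Reach-sym (subst (Reach F v) (sym q) (rep-reach v))))))
                (*-zeroʳ (surplus F S v)))

  -- Components of critical graphs

  enumerate : ∀ {N} (X : Subset N) → ∃ λ k → Σ (Fin k → Fin N) λ f → Injective _≡_ _≡_ f ×
    (∀ i → lookup X (f i) ≡ true) × (∀ v → lookup X v ≡ true → ∃ λ i → f i ≡ v)
  enumerate [] = 0 , (λ ()) , (λ { {()} }) , (λ ()) , λ ()
  enumerate (false ∷ X) with enumerate X
  ... | k , f , inj , mem , onto = k , suc ∘ f , (λ p → inj (suc-injective p)) , mem , λ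
    { (suc v) p → let (i , q) = onto v p in i , cong suc q }
  enumerate (true ∷ X) with enumerate X
  ... | k , f , inj , mem , onto = suc k , f⁺ , inj⁺ , mem⁺ , λ
    { zero _ → zero , refl ; (suc v) p → let (i , q) = onto v p in suc i , cong suc q }
    where
    f⁺ : Fin (suc k) → Fin _
    f⁺ zero = zero
    f⁺ (suc i) = suc (f i)
    inj⁺ : Injective _≡_ _≡_ f⁺
    inj⁺ {zero} {zero} p = refl
    inj⁺ {suc i} {suc j} p = cong suc (inj (suc-injective p))
    mem⁺ : ∀ i → lookup (true ∷ X) (f⁺ i) ≡ true
    mem⁺ zero = refl
    mem⁺ (suc i) = mem i

  component : ∀ {N} (F : Graph N) v → ∃ λ k → Σ (Graph k) λ H →
      ComponentIso F v H × 0 ℕ.< k × Connected H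
  component {N} F v with closure (λ x y → adj F x y ≟ᵇ true) {P = Reach F v}
      (λ x y p a → Reach-trans p (step a here)) v here
  ... | record { set = X ; start = vX ; sound = sound ; closed = closed } with enumerate X
  ... | k , f , inj , mem , onto =
      k , H , (f , inj , reached , (λ i → sound (f i) (mem i)) , λ i j → refl) ,
    nonempty (proj₁ (onto v vX)) , λ i j →
        inside (Reach-trans (Reach-sym (sound (f i) (mem i))) (sound (f j) (mem j))) refl refl
    where
    H : Graph k
    H = record { adj = λ i j → adj F (f i) (f j)
               ; adjSym = λ i j → adjSym F (f i) (f j) ; adjIrr = λ i → adjIrr F (f i) }
    stays : ∀ {x u} → lookup X x ≡ true → Reach F x u → lookup X u ≡ true
    stays xX here = xX
    stays xX (step a p) = stays (closed _ _ xX a) p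
    reached : ∀ u → Reach F v u → ∃ λ i → f i ≡ u
    reached u p = onto u (stays vX p)
    nonempty : Fin k → 0 ℕ.< k
    nonempty zero = ℕ.s≤s ℕ.z≤n
    nonempty (suc _) = ℕ.s≤s ℕ.z≤n
    inside : ∀ {x y} → Reach F x y → ∀ {i j} → f i ≡ x → f j ≡ y → Reach H i j
    inside here p q with inj (trans p (sym q))
    ... | refl = here
    inside (step {v = w} a r) {i} refl q with onto w (closed (f i) w (mem i) a)
    ... | i' , refl = step a (inside r refl q)

  -- Deciding whether a graph has a cycle

  -- The search runs over the tuples of values. A function agrees with the one rebuilt from its
  -- values only pointwise, so `P` has to respect pointwise equality.
  anyFunction? : ∀ ℓ {k} {P : (Fin ℓ → Fin k) → Set} → (∀ {f g} → (∀ i → f i ≡ g i) → P f → P g) →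
    (∀ f → Dec (P f)) → Dec (∃ P)
  anyFunction? zero {k} resp P? =
      map′ (λ p → none , p) (λ { (f , p) → resp {f} {none} (λ ()) p }) (P? none)
    where
    none : Fin 0 → Fin k
    none ()
  anyFunction? (suc ℓ) {k} {P} resp P? = map′
    (λ { (a , f , p) → cons a f , p })
    (λ { (f , p) → f zero , f ∘ suc , resp (λ { zero → refl ; (suc i) → refl }) p })
    (any? λ a → anyFunction? ℓ {P = λ f → P (cons a f)}
        (λ eq → resp (λ { zero → refl ; (suc i) → eq i })) (λ f → P? (cons a f)))
    where
    cons : Fin k → (Fin ℓ → Fin k) → Fin (suc ℓ) → Fin k
    cons a f zero = a
    cons a f (suc i) = f i

  next : ∀ {ℓ'} → Fin (suc ℓ') → Fin (suc ℓ')
  next {ℓ'} i = suc (toℕ i) mod suc ℓ'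

  CycleMap : ∀ {k} → Graph k → (ℓ' : ℕ) → (Fin (suc ℓ') → Fin k) → Set
  CycleMap G ℓ' f = (∀ x y → f x ≡ f y → x ≡ y) × (∀ i → adj G (f i) (f (next i)) ≡ true)

  -- HasCycle with its length bounded by the number of vertices, which makes it decidable.
  HasCycleMap : ∀ {k} → Graph k → Set
  HasCycleMap {k} G = ∃ λ ℓ' → ℓ' ℕ.< k × 3 ℕ.≤ suc ℓ' × ∃ (CycleMap G ℓ')

  hasCycleMap? : ∀ {k} (G : Graph k) → Dec (HasCycleMap G)
  hasCycleMap? {k} G = ℕ.anyUpTo? (λ ℓ' → (3 ℕ.≤? suc ℓ') ×-dec anyFunction? (suc ℓ')
    (λ { {f} {g} eq (inj , edge) → (λ x y p → inj x y (trans (eq x) (trans p (sym (eq y))))) ,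
         λ i → trans (cong₂ (adj G) (sym (eq i)) (sym (eq (next i)))) (edge i) })
    (λ f → all? (λ x → all? λ y → (f x ≟ f y) →-dec (x ≟ y)) ×-dec all? λ i →
        adj G (f i) (f (next i)) ≟ᵇ true)) k

  HasCycle⇒HasCycleMap : ∀ {k} {G : Graph k} → HasCycle G → HasCycleMap G
  HasCycle⇒HasCycleMap (suc ℓ' , ℓ≥3 , f , inj , edge) =
    ℓ' , injective⇒≤ inj , ℓ≥3 , f , (λ x y → inj) , edge

  module _ {ℓ' : ℕ} where

    toℕ-mod : ∀ {k} → k ℕ.< suc ℓ' → toℕ (k mod suc ℓ') ≡ k
    toℕ-mod {k} k<ℓ = trans (toℕ-fromℕ< _) (m<n⇒m%n≡m k<ℓ)

    mod-self : suc ℓ' mod suc ℓ' ≡ zero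
    mod-self = toℕ-injective (trans (toℕ-fromℕ< _) (n%n≡0 (suc ℓ')))

    mod-toℕ : ∀ (i : Fin (suc ℓ')) → toℕ i mod suc ℓ' ≡ i
    mod-toℕ i = toℕ-injective (toℕ-mod (toℕ<n i))

    next-mod : ∀ {k} → k ℕ.< suc ℓ' → next (k mod suc ℓ') ≡ suc k mod suc ℓ'
    next-mod k<ℓ = cong (λ z → suc z mod suc ℓ') (toℕ-mod k<ℓ)

    CycleMap⇒Cycle : ∀ {k} {G : Graph k} {f} → 3 ℕ.≤ suc ℓ' → CycleMap G ℓ' f →
        Cycle G (suc ℓ') (λ k → f (k mod suc ℓ'))
    CycleMap⇒Cycle {G = G} {f} ℓ≥3 (inj , edge) = record
      { long = ℓ≥3
      ; back = cong f (trans mod-self (sym (mod-toℕ zero)))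
      ; inj = λ {i} {j} i<ℓ j<ℓ p →
          trans (sym (toℕ-mod i<ℓ)) (trans (cong toℕ (inj _ _ p)) (toℕ-mod j<ℓ))
      ; edge = λ {k} k<ℓ → trans (cong (λ z → adj G (f (k mod suc ℓ')) (f z)) (sym (next-mod k<ℓ)))
          (edge (k mod suc ℓ')) }

    next≢ : 3 ℕ.≤ suc ℓ' → ∀ (x : Fin (suc ℓ')) → next x ≢ x
    next≢ ℓ≥3 x p with suc (toℕ x) ℕ.≟ suc ℓ'
    ... | no ne = ℕ.1+n≢n (trans (sym (toℕ-mod (ℕ.≤∧≢⇒< (toℕ<n x) ne))) (cong toℕ p))
    ... | yes eq with trans (cong toℕ (sym p)) (cong toℕ (trans (cong (_mod suc ℓ') eq) mod-self))
    ... | x≡0 with trans (sym (cong suc x≡0)) eq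
    next≢ (ℕ.s≤s ()) x p | yes eq | x≡0 | refl

    module _ (ℓ≥3 : 3 ℕ.≤ suc ℓ') where

      cycleGraph-adj⇒ : ∀ x y → adj (cycleGraph (suc ℓ') ℓ≥3) x y ≡ true → y ≡ next x ⊎ x ≡ next y
      cycleGraph-adj⇒ x y p with y ≟ next x | x ≟ next y
      ... | yes q | _ = inj₁ q
      ... | no _ | yes q = inj₂ q
      cycleGraph-adj⇒ x y () | no _ | no _

      cycleGraph-adj⇐ : ∀ x y → y ≡ next x ⊎ x ≡ next y → adj (cycleGraph (suc ℓ') ℓ≥3) x y ≡ true
      cycleGraph-adj⇐ x y s with y ≟ next x | x ≟ next y | x ≟ y
      ... | yes _ | _ | no _ = refl
      ... | no _ | yes _ | no _ = refl
      ... | yes p | _ | yes q = ⊥-elim (next≢ ℓ≥3 x (trans (sym p) (sym q)))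
      ... | no _ | yes p | yes q = ⊥-elim (next≢ ℓ≥3 y (trans (sym p) q))
      ... | no p | no q | _ = ⊥-elim ([ p , q ]′ s)

      cycleGraph-cycle : Cycle (cycleGraph (suc ℓ') ℓ≥3) (suc ℓ') (_mod suc ℓ')
      cycleGraph-cycle = CycleMap⇒Cycle {G = cycleGraph (suc ℓ') ℓ≥3} {id} ℓ≥3
        ((λ x y p → p) , λ i → cycleGraph-adj⇐ i (next i) (inj₁ refl))

  -- Components of a critical graph are short odd cycles or critical trees

  module Structure (m n : ℤ) (0<m : 0ℤ < m) (m<n : m < n) where

    open Bounds m n 0<m m<n
    open Minimal m n 0<m m<n
    open Components m n 0<m m<n

    -- Weight one half on every edge is a factor of a cycle; scaled by 2m it is the constant weight
    -- m, with all degrees 2m.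
    C1-cycleGraph : ∀ ℓ (ℓ≥3 : 3 ℕ.≤ ℓ) → C1 (cycleGraph ℓ ℓ≥3)
    C1-cycleGraph (suc ℓ') ℓ≥3 =
        Factor⇒C1 {G = cycleGraph (suc ℓ') ℓ≥3} {+ 2} {Q (λ _ → m) ℓ} (+<+ (ℕ.s≤s ℕ.z≤n)) (record
      { weight = Weight-Q (λ _ → m) ℓ ℕ.≤-refl
      ; nonneg = Q≥0 (λ _ → m) ℓ (λ _ _ → <⇒≤ 0<m)
      ; lower = λ v → ≤-reflexive (sym (deg v))
      ; upper = λ v → subst (_≤ + 2 * n) (sym (deg v)) (*-monoˡ {+ 2} (+≤+ ℕ.z≤n) (<⇒≤ m<n)) })
      where
      open Around (cycleGraph-cycle ℓ≥3)
      deg : ∀ v → δ (Q (λ _ → m) ℓ) v ≡ + 2 * m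
      deg v = trans (δ-Q-closed (λ _ → m) refl v)
          (trans (cong (degree (λ _ → m) ℓ) (sym (mod-toℕ v)))
        (trans (degree-on (λ _ → m) ℓ (toℕ<n v) ℕ.≤-refl) (l m)))
        where
        l : ∀ m → m + m ≡ + 2 * m
        l = solve-∀

    -- The inequality is i < m / (n - m) with the denominator cleared.
    ShortOddCycle : ∀ {N} → Graph N → Fin N → Set
    ShortOddCycle F v = ∃ λ i → Σ (3 ℕ.≤ suc (i ℕ.+ i)) λ ℓ≥3 → 1 ℕ.≤ i × + i * n < + (suc i) * m ×
      ComponentIso F v (cycleGraph (suc (i ℕ.+ i)) ℓ≥3)

    cycle-component : ∀ {N} {F : Graph N} {v k} {H : Graph k} → ComponentIso F v H → Connected H →
        Critical H →
      HasCycleMap H → ShortOddCycle F v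
    cycle-component {F = F} {v} {k} {H} (f , f-inj , f-onto , f-reach , f-same) conn critical
        (ℓ' , _ , ℓ≥3 , φ , cyc@(φ-inj , φ-edge)) =
      result (CC.cycle-odd)
      where
      module CC = CriticalCycle m n 0<m m<n {F = H} critical (CycleMap⇒Cycle {G = H} {φ} ℓ≥3 cyc)
      open Around (CycleMap⇒Cycle {G = H} {φ} ℓ≥3 cyc)
      -- Every edge at a vertex of the cycle is an edge of the cycle, so in the connected graph H
      -- the cycle reaches all vertices.
      stays : ∀ {a b} → OnCycle a → Reach H a b → OnCycle b
      stays on here = on
      stays on (step a p) = stays (proj₂ (CycleEdge⇒OnCycle (CC.no-other-edge on a))) p
      everywhere : ∀ u → OnCycle u
      everywhere u = stays (0 , ℕ.s≤s ℕ.z≤n , refl) (conn (φ (0 mod suc ℓ')) u)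
      φ-onto : ∀ u → ∃ λ j → φ j ≡ u
      φ-onto u with everywhere u
      ... | j , _ , p = j mod suc ℓ' , sym p
      φ-same : ∀ i j → adj (cycleGraph (suc ℓ') ℓ≥3) i j ≡ adj H (φ i) (φ j)
      φ-same i j = Bool-ext
        (λ a → [ (λ { refl → φ-edge i }) , (λ { refl → adj-flip H (φ-edge j) }) ]′
            (cycleGraph-adj⇒ ℓ≥3 i j a))
        (λ a → cycleGraph-adj⇐ ℓ≥3 i j (consecutive (CC.no-other-edge (everywhere (φ i)) a)))
        where
        consecutive : CycleEdge (φ i) (φ j) → j ≡ next i ⊎ i ≡ next j
        consecutive (t , t<ℓ , inj₁ (p , q)) with φ-inj _ _ p
        ... | refl = inj₁ (trans (φ-inj _ _ q) (sym (next-mod t<ℓ)))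
        consecutive (t , t<ℓ , inj₂ (p , q)) with φ-inj _ _ q
        ... | refl = inj₂ (trans (φ-inj _ _ p) (sym (next-mod t<ℓ)))
      cycle-iso : ComponentIso F v (cycleGraph (suc ℓ') ℓ≥3)
      cycle-iso = f ∘ φ , (λ p → φ-inj _ _ (f-inj p)) ,
        (λ u r → let (i , p) = f-onto u r ; (j , q) = φ-onto i in j , trans (cong f q) p) ,
        (λ j → f-reach (φ j)) , λ i j → trans (φ-same i j) (f-same (φ i) (φ j))
      result : (∃ λ i → suc ℓ' ≡ suc (i ℕ.+ i)) → ShortOddCycle F v
      result (zero , refl) = ⊥-elim (ℕ.<⇒≱ (ℕ.s≤s (ℕ.s≤s ℕ.z≤n)) ℓ≥3)
      result (suc i , refl) =
          suc i , ℓ≥3 , ℕ.s≤s ℕ.z≤n , CC.short {suc i} refl (+<+ (ℕ.s≤s ℕ.z≤n)) , cycle-iso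

    CriticalTree : ∀ {N} → Graph N → Fin N → Set
    CriticalTree F v = ∃ λ k → Σ (Graph k) λ H → IsTree H × Critical H × ComponentIso F v H

    critical-component : ∀ {N} {F : Graph N} → Critical F → ∀ v →
        ShortOddCycle F v ⊎ CriticalTree F v
    critical-component {F = F} critical v with component F v
    ... | k , H , iso , 0<k , conn with hasCycleMap? H
    ... | yes c = inj₁ (cycle-component {F = F} {v} {H = H} iso conn
      (Critical-embeds {H = H} {F} (component-embeds {F = F} {v} {H} iso) critical) c)
    ... | no acyclic = inj₂ (k , H , (0<k , conn , λ c → acyclic (HasCycle⇒HasCycleMap {G = H} c)) ,
      Critical-embeds {H = H} {F} (component-embeds {F = F} {v} {H} iso) critical , iso)

  -- Rational numbers

  module ℚSum = OrderedSum ℚ.+-0-isCommutativeMonoid ℚ.≤-isPreorder ℚ.+-mono-≤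

  module _ {d : ℕ} .{{_ : ℕ.NonZero d}} where

    toℚᵘ-/ : ∀ a → ℚ.toℚᵘ (a ℚ./ d) ℚᵘ.≃ a ℚᵘ./ d
    toℚᵘ-/ a = go d
      where
      -- Division reduces only at a successor denominator, and `d` is a module parameter; `go`
      -- abstracts over it again to allow the match.
      go : ∀ d .{{_ : ℕ.NonZero d}} → ℚ.toℚᵘ (a ℚ./ d) ℚᵘ.≃ a ℚᵘ./ d
      go (suc d') = ℚ.toℚᵘ-fromℚᵘ (ℚᵘ.mkℚᵘ a d')

    ↥-/ᵘ : ∀ a → ℚᵘ.↥ (a ℚᵘ./ d) ≡ a
    ↥-/ᵘ a = go d
      where
      go : ∀ d .{{_ : ℕ.NonZero d}} → ℚᵘ.↥ (a ℚᵘ./ d) ≡ a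
      go (suc d') = refl

    ↧-/ᵘ : ∀ a → ℚᵘ.↧ (a ℚᵘ./ d) ≡ + d
    ↧-/ᵘ a = go d
      where
      go : ∀ d .{{_ : ℕ.NonZero d}} → ℚᵘ.↧ (a ℚᵘ./ d) ≡ + d
      go (suc d') = refl

  module _ {d d' : ℕ} .{{_ : ℕ.NonZero d}} .{{_ : ℕ.NonZero d'}} where

    /-mono-≤ : ∀ {a a'} → a * + d' ≤ a' * + d → a ℚ./ d ℚ.≤ a' ℚ./ d'
    /-mono-≤ {a} {a'} p =
        ℚ.toℚᵘ-cancel-≤ (ℚᵘ.≤-respˡ-≃ (ℚᵘ.≃-sym (toℚᵘ-/ a)) (ℚᵘ.≤-respʳ-≃ (ℚᵘ.≃-sym (toℚᵘ-/ a'))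
      (ℚᵘ.*≤* (subst₂ _≤_ (sym (cong₂ _*_ (↥-/ᵘ a) (↧-/ᵘ a'))) (sym (cong₂ _*_ (↥-/ᵘ a') (↧-/ᵘ a)))
          p))))

    /-cancel-≤ : ∀ {a a'} → a ℚ./ d ℚ.≤ a' ℚ./ d' → a * + d' ≤ a' * + d
    /-cancel-≤ {a} {a'} p with ℚᵘ.≤-respˡ-≃ (toℚᵘ-/ a) (ℚᵘ.≤-respʳ-≃ (toℚᵘ-/ a') (ℚ.toℚᵘ-mono-≤ p))
    ... | ℚᵘ.*≤* q = subst₂ _≤_ (cong₂ _*_ (↥-/ᵘ a) (↧-/ᵘ a')) (cong₂ _*_ (↥-/ᵘ a') (↧-/ᵘ a)) q

    /-mono-< : ∀ {a a'} → a * + d' < a' * + d → a ℚ./ d ℚ.< a' ℚ./ d'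
    /-mono-< {a} {a'} p =
        ℚ.toℚᵘ-cancel-< (ℚᵘ.<-respˡ-≃ (ℚᵘ.≃-sym (toℚᵘ-/ a)) (ℚᵘ.<-respʳ-≃ (ℚᵘ.≃-sym (toℚᵘ-/ a'))
      (ℚᵘ.*<* (subst₂ _<_ (sym (cong₂ _*_ (↥-/ᵘ a) (↧-/ᵘ a'))) (sym (cong₂ _*_ (↥-/ᵘ a') (↧-/ᵘ a)))
          p))))

  module _ {d : ℕ} .{{_ : ℕ.NonZero d}} where

    +-/ : ∀ a b → a ℚ./ d ℚ.+ b ℚ./ d ≡ (a + b) ℚ./ d
    +-/ a b = ℚ.toℚᵘ-injective (ℚᵘ.≃-trans (ℚ.toℚᵘ-homo-+ (a ℚ./ d) (b ℚ./ d))
      (ℚᵘ.≃-trans (ℚᵘ.+-cong (toℚᵘ-/ a) (toℚᵘ-/ b))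
          (ℚᵘ.≃-trans (go d) (ℚᵘ.≃-sym (toℚᵘ-/ (a + b))))))
      where
      go : ∀ d .{{_ : ℕ.NonZero d}} → a ℚᵘ./ d ℚᵘ.+ b ℚᵘ./ d ℚᵘ.≃ (a + b) ℚᵘ./ d
      go (suc d') = ℚᵘ.*≡* (trans (l a b (+ suc d'))
          (cong ((a + b) *_) (sym (pos-* (suc d') (suc d')))))
        where
        l : ∀ a b d → (a * d + b * d) * d ≡ (a + b) * (d * d)
        l = solve-∀

    *-/1 : ∀ a b → (a ℚ./ d) ℚ.* (b ℚ./ 1) ≡ (a * b) ℚ./ d
    *-/1 a b = ℚ.toℚᵘ-injective (ℚᵘ.≃-trans (ℚ.toℚᵘ-homo-* (a ℚ./ d) (b ℚ./ 1))
      (ℚᵘ.≃-trans (ℚᵘ.*-cong (toℚᵘ-/ a) (toℚᵘ-/ b))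
          (ℚᵘ.≃-trans (go d) (ℚᵘ.≃-sym (toℚᵘ-/ (a * b))))))
      where
      go : ∀ d .{{_ : ℕ.NonZero d}} → (a ℚᵘ./ d) ℚᵘ.* (b ℚᵘ./ 1) ℚᵘ.≃ (a * b) ℚᵘ./ d
      go (suc d') = ℚᵘ.*≡* (cong (a * b *_) (cong +_ (sym (ℕ.*-identityʳ (suc d')))))

    0-/ : 0ℤ ℚ./ d ≡ 0ℚ
    0-/ = ℚ.toℚᵘ-injective (ℚᵘ.≃-trans (toℚᵘ-/ 0ℤ) (go d))
      where
      go : ∀ d .{{_ : ℕ.NonZero d}} → 0ℤ ℚᵘ./ d ℚᵘ.≃ ℚᵘ.0ℚᵘ
      go (suc d') = ℚᵘ.*≡* refl

    d-/ : (+ d) ℚ./ d ≡ 1ℚ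
    d-/ = ℚ.toℚᵘ-injective (ℚᵘ.≃-trans (toℚᵘ-/ (+ d)) (go d))
      where
      go : ∀ d .{{_ : ℕ.NonZero d}} → (+ d) ℚᵘ./ d ℚᵘ.≃ ℚᵘ.1ℚᵘ
      go (suc d') = ℚᵘ.*≡* (*-comm (+ suc d') (+ 1))

    sum-/ : ∀ {k} (f : Fin k → ℤ) → ℚSum.sum (λ i → f i ℚ./ d) ≡ sum f ℚ./ d
    sum-/ {zero} f = sym 0-/
    sum-/ {suc k} f = trans (cong (f zero ℚ./ d ℚ.+_) (sum-/ (f ∘ suc)))
        (+-/ (f zero) (sum (f ∘ suc)))

    pick-/ : ∀ b a → ℚSum.pick b (a ℚ./ d) ≡ pick b a ℚ./ d
    pick-/ true a = refl
    pick-/ false a = sym 0-/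

  sum-subset : ∀ {k} (S : Subset k) x → sum (λ v → pick (lookup S v) x) ≡ + ∣ S ∣ * x
  sum-subset [] x = refl
  sum-subset (true ∷ S) x = trans (cong (λ z → x + z) (sum-subset S x)) (l x (+ ∣ S ∣))
    where
    l : ∀ x c → x + c * x ≡ (1ℤ + c) * x
    l = solve-∀
  sum-subset (false ∷ S) x = trans (+-identityˡ _) (sum-subset S x)

  sum-filter : ∀ {k} (b : Fin k → Bool) x →
    sum (λ v → pick (b v) x) ≡ + List.length (List.filter (λ v → T? (b v)) (List.allFin k)) * x
  sum-filter {k} b x = go k id
    where
    go : ∀ j (g : Fin j → Fin k) →
      sum (λ v → pick (b (g v)) x) ≡ + List.length (List.filter (λ v → T? (b v)) (List.tabulate g))
          * x
    go zero g = refl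
    go (suc j) g with b (g zero)
    ... | true = trans (cong (λ z → x + z) (go j (g ∘ suc)))
        (l x (+ List.length (List.filter (λ v → T? (b v)) (List.tabulate (g ∘ suc)))))
      where
      l : ∀ x c → x + c * x ≡ (1ℤ + c) * x
      l = solve-∀
    ... | false = trans (+-identityˡ _) (go j (g ∘ suc))

  -- Translation between the rational statements and their integral forms

  module Equivalences (n m : ℕ) .{{_ : ℕ.NonZero m}} {{_ : ℕ.NonZero (n ℕ.∸ m)}} where

    m<n : m ℕ.< n
    m<n = ℕ.m∸n≢0⇒n<m (ℕ.≢-nonZero⁻¹ (n ℕ.∸ m))

    0<+m : 0ℤ < + m
    0<+m = +<+ (ℕ.>-nonZero⁻¹ m)

    open Bounds (+ m) (+ n) 0<+m (+<+ m<n)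
    open Minimal (+ m) (+ n) 0<+m (+<+ m<n)
    open Components (+ m) (+ n) 0<+m (+<+ m<n)
    open Structure (+ m) (+ n) 0<+m (+<+ m<n)

    q : ℚ
    q = (+ n) ℚ./ m

    r : ℚ
    r = (+ m) ℚ./ (n ℕ.∸ m)

    Toughness : ∀ {N} → Graph N → Set
    Toughness {N} G = ∀ (S : Subset N) → ℕtoℚ (iso- G S) ℚ.≤ q ℚ.* ℕtoℚ ∣ S ∣

    sums : ∀ {N} (G : Graph N) S →
      (sum (λ v → pick (isIsolatedIn- G S v) (+ m)) ≡ + iso- G S * + m) ×
      (sum (λ v → pick (lookup S v) (+ n)) ≡ + n * + ∣ S ∣ * + 1)
    sums G S = sum-filter (isIsolatedIn- G S) (+ m) ,
      trans (sum-subset S (+ n))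
          (trans (*-comm (+ ∣ S ∣) (+ n)) (sym (*-identityʳ (+ n * + ∣ S ∣))))

    C1⇒Toughness : ∀ {N} (G : Graph N) → C1 G → Toughness G
    C1⇒Toughness G c1 S = subst (ℕtoℚ (iso- G S) ℚ.≤_) (sym (*-/1 (+ n) (+ ∣ S ∣)))
      (/-mono-≤ {1} {m} {+ iso- G S} {+ n * + ∣ S ∣}
          (subst₂ _≤_ (proj₁ (sums G S)) (proj₂ (sums G S)) (c1 S)))

    Toughness⇒C1 : ∀ {N} (G : Graph N) → Toughness G → C1 G
    Toughness⇒C1 G t S = subst₂ _≤_ (sym (proj₁ (sums G S))) (sym (proj₂ (sums G S)))
      (/-cancel-≤ {1} {m} {+ iso- G S} {+ n * + ∣ S ∣}
          (subst (ℕtoℚ (iso- G S) ℚ.≤_) (*-/1 (+ n) (+ ∣ S ∣)) (t S)))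

    Violates⇒ : ∀ {N} (G : Graph N) {S} → Violates G S → q ℚ.* ℕtoℚ ∣ S ∣ ℚ.< ℕtoℚ (iso- G S)
    Violates⇒ G {S} v = subst (ℚ._< ℕtoℚ (iso- G S)) (sym (*-/1 (+ n) (+ ∣ S ∣)))
      (/-mono-< {m} {1} {+ n * + ∣ S ∣} {+ iso- G S}
          (subst₂ _<_ (proj₂ (sums G S)) (proj₁ (sums G S)) v))

    FracFactor : ∀ {N} → Graph N → Set
    FracFactor {N} G = Σ (Fin N → Fin N → ℚ) λ h → IsFracFactor G 1ℚ q h

    IntegralFracFactor : ∀ {N} → Graph N → Set
    IntegralFracFactor {N} G = Σ (Fin N → Fin N → ℚ) λ h → IsFracFactor G 1ℚ q h ×
      (∀ u v → adj G u v ≡ true → Σ ℕ λ j → (j ℕ.≤ m) × (h u v ≡ (+ j) ℚ./ m))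

    -- Double counting over ℚ, with the lower bound 1 written as m / m: then both totals have
    -- denominator m and can be compared by their numerators.
    FracFactor⇒C1 : ∀ {N} (G : Graph N) → FracFactor G → C1 G
    FracFactor⇒C1 {N} G (h , h-sym , range , deg) S =
        *-cancelʳ-≤-pos isolated bounding (+ m) {{positive 0<+m}}
      (/-cancel-≤ {m} {m} {isolated} {bounding}
          (subst₂ ℚ._≤_ (total (isIsolatedIn- G S) (+ m)) (total (lookup S) (+ n))
        (ℚSum.isolated-bound G S h ((+ m) ℚ./ m) q h-sym (λ u v a → proj₁ (range u v a))
          (λ v → subst₂ ℚ._≤_ (sym d-/) (degh≡ v) (proj₁ (deg v)))
          (λ v → subst (ℚ._≤ q) (degh≡ v) (proj₂ (deg v))))))
      where
      isolated = sum (λ v → pick (isIsolatedIn- G S v) (+ m))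
      bounding = sum (λ v → pick (lookup S v) (+ n))
      degh≡ : ∀ v → degh G h v ≡ ℚSum.sum (λ u → ℚSum.pick (adj G v u) (h v u))
      degh≡ v = ℚSum.foldr-allFin (λ u → ℚSum.pick (adj G v u) (h v u))
      total : ∀ (b : Fin N → Bool) x →
          ℚSum.sum (λ v → ℚSum.pick (b v) (x ℚ./ m)) ≡ sum (λ v → pick (b v) x) ℚ./ m
      total b x = trans (ℚSum.sum-cong λ v → pick-/ (b v) x) (sum-/ (λ v → pick (b v) x))

    C1⇒IntegralFracFactor : ∀ {N} (G : Graph N) → C1 G → IntegralFracFactor G
    C1⇒IntegralFracFactor {N} G c1 with Augment.C1⇒Factor (+ m) (+ n) 0<+m (+<+ m<n) G c1
    ... | h , H = (λ u v → cap u v ℚ./ m) ,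
      ((λ u v → cong (λ z → (z ⊓ + m) ℚ./ m) (proj₁ (H .weight) u v)) ,
       (λ u v _ → subst (ℚ._≤ cap u v ℚ./ m) 0-/ (/-mono (cap≥0 u v)) ,
                  subst (cap u v ℚ./ m ℚ.≤_) d-/ (/-mono (i⊓j≤j (h u v) (+ m)))) ,
       (λ v → subst₂ ℚ._≤_ d-/ (sym (degh≡ v)) (/-mono (lo v)) ,
              subst (ℚ._≤ q) (sym (degh≡ v)) (/-mono (up v)))) ,
      λ u v _ → abs (cap u v) ,
        drop‿+≤+ (subst (_≤ + m) (sym (0≤i⇒+∣i∣≡i (cap≥0 u v))) (i⊓j≤j (h u v) (+ m))) ,
        cong (ℚ._/ m) (sym (0≤i⇒+∣i∣≡i (cap≥0 u v)))
      where
      /-mono : ∀ {a b} → a ≤ b → a ℚ./ m ℚ.≤ b ℚ./ m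
      /-mono {a} {b} p = /-mono-≤ {m} {m} {a} {b} (*-monoʳ-≤-nonNeg (+ m) p)
      cap : EdgeFun N
      cap u v = h u v ⊓ + m
      cap≥0 : ∀ u v → 0ℤ ≤ cap u v
      cap≥0 u v = ⊓-glb (H .nonneg u v) (<⇒≤ 0<+m)
      degh≡ : ∀ v → degh G (λ u v → cap u v ℚ./ m) v ≡ δ cap v ℚ./ m
      degh≡ v = trans (ℚSum.foldr-allFin (λ u → ℚSum.pick (adj G v u) (cap v u ℚ./ m)))
        (trans (ℚSum.sum-cong λ u → entry u) (sum-/ (cap v)))
        where
        entry : ∀ u → ℚSum.pick (adj G v u) (cap v u ℚ./ m) ≡ cap v u ℚ./ m
        entry u with adj G v u in eq
        ... | true = refl
        ... | false = sym (trans (cong (λ z → (z ⊓ + m) ℚ./ m) (proj₂ (H .weight) v u eq))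
          (trans (cong (ℚ._/ m) (i≤j⇒i⊓j≡i (<⇒≤ 0<+m))) 0-/))
      up : ∀ v → δ cap v ≤ + n
      up v = ≤-trans (sum-mono λ u → i⊓j≤i (h v u) (+ m))
          (subst (δ h v ≤_) (*-identityˡ (+ n)) (H .upper v))
      -- An entry above m still contributes m after the cut, which alone suffices; without such an
      -- entry nothing is cut at `v`.
      lo : ∀ v → + m ≤ δ cap v
      lo v with any? (λ u → + m <? h v u)
      ... | yes (u , big) = subst (_≤ δ cap v) (i≥j⇒i⊓j≡j (<⇒≤ big)) (term≤sum (cap≥0 v) u)
      ... | no small = subst₂ _≤_ (*-identityˡ (+ m))
        (sum-cong λ u → sym (i≤j⇒i⊓j≡i (≮⇒≥ λ p → small (u , p)))) (H .lower v)

    C1⇒HasFamilyFactor : ∀ {N} (G : Graph N) → C1 G → HasFamilyFactor G q r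
    C1⇒HasFamilyFactor G c1 with critical-subgraph G c1
    ... | F , sub , critical = F , sub , λ v → piece v (critical-component {F = F} critical v)
      where
      -- Subtracting i m on both sides turns the hypothesis into i (n - m) < m.
      below-r : ∀ i → + i * + n < + (suc i) * + m → ℕtoℚ i ℚ.< r
      below-r i p = /-mono-< {1} {n ℕ.∸ m} {+ i} {+ m} (subst₂ _<_
        (trans (l₁ (+ i) (+ n) (+ m)) (cong (+ i *_) (trans (m-n≡m⊖n n m) (⊖-≥ (ℕ.<⇒≤ m<n)))))
        (l₂ (+ i) (+ m)) (+-monoˡ-< (- (+ i * + m)) p))
        where
        l₁ : ∀ i n m → i * n - i * m ≡ i * (n - m)
        l₁ = solve-∀
        l₂ : ∀ i m → (1ℤ + i) * m - i * m ≡ m * 1ℤ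
        l₂ = solve-∀
      piece : ∀ v → ShortOddCycle F v ⊎ CriticalTree F v → Σ ℕ λ k → Σ (Graph k) λ H →
          InFamily q r H × ComponentIso F v H
      piece v (inj₁ (i , ℓ≥3 , 1≤i , short , iso)) =
          suc (i ℕ.+ i) , cycleGraph (suc (i ℕ.+ i)) ℓ≥3 ,
        inj₁ (i , 1≤i , below-r i short , refl , id , (λ p → p) , (λ y → y , refl) , (λ x y → refl))
            , iso
      piece v (inj₂ (k , H , tree , (c1H , crit) , iso)) = k , H ,
        inj₂ (tree , C1⇒Toughness H c1H , λ a b ab → let (S , v) = crit a b ab in S , Violates⇒ (deleteEdge H a b) {S} v) , iso

    HasFamilyFactor⇒C1 : ∀ {N} (G : Graph N) → HasFamilyFactor G q r → C1 G
    HasFamilyFactor⇒C1 G (F , sub , pieces) = C1-mono {F = F} {G} sub (C1-components {F = F} λ v →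
      let (k , H , fam , iso) = pieces v in k , H , member fam , iso)
      where
      member : ∀ {k} {H : Graph k} → InFamily q r H → C1 H
      member {H = H} (inj₁ (i , 1≤i , _ , refl , g , inj , surj , same)) =
        C1-embeds {H = H} {cycleGraph (suc (i ℕ.+ i)) ℓ≥3}
          (record { inj = inj ; same = same ; closed = λ _ u _ → surj u })
              (C1-cycleGraph (suc (i ℕ.+ i)) ℓ≥3)
        where
        ℓ≥3 = ℕ.s≤s (ℕ.+-mono-≤ 1≤i 1≤i)
      member {H = H} (inj₂ (_ , tough , _)) = Toughness⇒C1 H tough

    main : ∀ {N} (G : Graph N) →
      (Toughness G ⇔ FracFactor G) × (Toughness G ⇔ IntegralFracFactor G) ×
          (Toughness G ⇔ HasFamilyFactor G q r)
    main G =
      mk⇔ (λ t → let (h , H , _) = C1⇒IntegralFracFactor G (Toughness⇒C1 G t) in h , H) (C1⇒Toughness G ∘ FracFactor⇒C1 G) ,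
      mk⇔ (C1⇒IntegralFracFactor G ∘ Toughness⇒C1 G)
          (λ { (h , H , _) → C1⇒Toughness G (FracFactor⇒C1 G (h , H)) }) ,
      mk⇔ (C1⇒HasFamilyFactor G ∘ Toughness⇒C1 G) (C1⇒Toughness G ∘ HasFamilyFactor⇒C1 G)

open import Data.Nat using (ℕ; NonZero; _∸_)
open import Data.Integer using (+_)
open import Data.Rational using (ℚ; _/_; _*_; _≤_; 1ℚ)
open import Data.Fin using (Fin)
open import Data.Fin.Subset using (Subset; ∣_∣)
open import Data.Product using (Σ; _×_)
open import Relation.Binary.PropositionalEquality using (_≡_)
open import Function.Bundles using (_⇔_)
open import Data.Bool using (true)

theorem1p6 : ∀ {N} (G : Graph N) (n m : ℕ) .{{_ : NonZero m}} {{_ : NonZero (n ∸ m)}} →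
  let q = (+ n) / m
      r = (+ m) / (n ∸ m)
      c1 = ∀ (S : Subset N) → ℕtoℚ (iso- G S) ≤ q * ℕtoℚ ∣ S ∣
      c2 = Σ (Fin N → Fin N → ℚ) λ h → IsFracFactor G 1ℚ q h
      c3 = Σ (Fin N → Fin N → ℚ) λ h → IsFracFactor G 1ℚ q h
             × (∀ u v → adj G u v ≡ true → Σ ℕ λ j → (j Data.Nat.≤ m) × (h u v ≡ (+ j) / m))
      c4 = HasFamilyFactor G q r
  in (c1 ⇔ c2) × (c1 ⇔ c3) × (c1 ⇔ c4)
theorem1p6 G n m = Integral.Equivalences.main n m G
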